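{- Let $m\ge1$, $n=2m$, $k\ge1$, let $U$ be the cyclic subgroup of $\mathbb{F}_{2^n}^*$ of order $2^m+1$, let $u_0\in U\setminus\{1\}$, and let $T_{u_0}(x)=\mathrm{Tr}_m^n\big(u_0\sum_{i=1}^{2^{m-1}}x^{i(2^m-1)}\big)$ for $x\in\mathbb{F}_{2^n}$. Let $h:\mathbb{F}_{2^m}\to\mathbb{F}_2^k$ be a balanced function with $h(0)=0$. Then $x\mapsto h(T_{u_0}(x))$ is a vectorial hyper-bent function from $\mathbb{F}_{2^n}$ to $\mathbb{F}_2^k$.
   Context: $\mathrm{Tr}_m^n(y)=y+y^{2^m}$. A function $h:\mathbb{F}_{2^m}\to\mathbb{F}_2^k$ is balanced if $\#\{x\in\mathbb{F}_{2^m}:h(x)=b\}=2^{m-k}$ for every $b\in\mathbb{F}_2^k$. A Boolean function $f:\mathbb{F}_{2^n}\to\mathbb{F}_2$ is hyper-bent if for every $\lambda\in\mathbb{F}_{2^n}$ and every integer $t$ with $\gcd(t,2^n-1)=1$, $\sum_{x\in\mathbb{F}_{2^n}}(-1)^{f(x)+\mathrm{Tr}_1^n(\lambda x^t)}\in\{\pm2^{n/2}\}$ ($\mathrm{Tr}_1^n$ the absolute trace). A function $F:\mathbb{F}_{2^n}\to\mathbb{F}_2^k$ is vectorial hyper-bent if $x\mapsto\langle v,F(x)\rangle$ is hyper-bent for every nonzero $v\in\mathbb{F}_2^k$.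
   Formalization: The formal statement assumes m ≥ 2 instead of m ≥ 1: for m = 1 the hypotheses force k = 1 and h the identity, so h(T_{u_0}(x)) = Tr(u_0 x) is linear with Walsh sum 4 at λ = u_0, t = 1, and the claim fails. -}

module Defs where

open import Algebra.Bundles using (CommutativeRing)
open import Algebra.Structures using (IsCommutativeRing)
import Algebra.Properties.CommutativeMonoid.Sum as Sum
import Algebra.Properties.CommutativeSemiring.Exp as Exp
import Algebra.Properties.Ring as RingProperties
import Algebra.Properties.Semiring.Mult as Mult
open import Data.Bool.Base using (Bool; true; false; _∧_; _xor_)
open import Data.Empty using (⊥-elim)
open import Data.Fin.Base using (Fin; zero; suc; toℕ; punchIn)
open import Data.Fin.Permutation using (Permutation)
import Data.Fin.Properties as Fin
open import Data.Integer.Base as ℤ using (ℤ; +_; -[1+_]; -1ℤ; 1ℤ)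
import Data.Integer.GCD as ℤ
import Data.Integer.Properties as ℤ
open import Data.Nat.Base as ℕ using (ℕ; zero; suc; _∸_)
import Data.Nat.Properties as ℕ
open import Data.Product.Base using (Σ; ∃-syntax; _×_; _,_; proj₁; proj₂)
open import Data.Sum.Base using (_⊎_)
open import Data.Vec.Base using (Vec; foldr′; replicate; zipWith)
open import Data.Vec.Functional using (removeAt)
open import Function.Base using (_∘_)
open import Function.Bundles using (Inverse; _↔_; _⇔_; mk↔ₛ′)
open import Function.Definitions using (Injective)
open import Level using (0ℓ)
open import Relation.Binary.Definitions using (DecidableEquality)
open import Relation.Binary.PropositionalEquality using (_≡_; _≢_; refl; sym; trans; cong; cong₂; module ≡-Reasoning)
open import Relation.Nullary.Decidable using (yes; no; map′)
open import Relation.Unary using (Pred)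

record FiniteField (q : ℕ) : Set₁ where
  infixl 6 _+_
  infixl 7 _*_
  infix  8 -_
  field
    Carrier           : Set
    _+_ _*_           : Carrier → Carrier → Carrier
    -_                : Carrier → Carrier
    0# 1#             : Carrier
    isCommutativeRing : IsCommutativeRing _≡_ _+_ _*_ -_ 0# 1#
    0≢1               : 0# ≢ 1#
    invertible        : ∀ x → x ≢ 0# → ∃[ y ] x * y ≡ 1#
    enumeration       : Fin q ↔ Carrier

  commutativeRing : CommutativeRing 0ℓ 0ℓ
  commutativeRing = record { isCommutativeRing = isCommutativeRing }

𝔽₂^ : ℕ → Set
𝔽₂^ k = Vec Bool k

𝟎 : ∀ {k} → 𝔽₂^ k
𝟎 = replicate _ false

⟨_,_⟩ : ∀ {k} → 𝔽₂^ k → 𝔽₂^ k → Bool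
⟨ v , w ⟩ = foldr′ _xor_ false (zipWith _∧_ v w)

-1^ : Bool → ℤ
-1^ false = 1ℤ
-1^ true  = -1ℤ

module FieldOps {q : ℕ} (K : FiniteField q) where
  open FiniteField K public using (Carrier; _+_; _*_; -_; 0#; 1#)
  open FiniteField K using (0≢1; invertible; enumeration; commutativeRing)
  open CommutativeRing commutativeRing public
    using (+-assoc; +-comm; +-identityˡ; +-identityʳ; -‿inverseˡ; -‿inverseʳ;
           *-assoc; *-comm; *-identityˡ; *-identityʳ; zeroˡ; zeroʳ; distribˡ; distribʳ)
  open CommutativeRing commutativeRing
    using (ring; semiring; commutativeSemiring; +-commutativeMonoid; *-commutativeMonoid)
  open Exp commutativeSemiring public using (_^_; ^-homo-*; ^-assocʳ; ^-distrib-*)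

  module Additive       = Sum +-commutativeMonoid
  module Multiplicative = Sum *-commutativeMonoid
  private module Integer = Sum ℤ.+-0-commutativeMonoid

  elem : Fin q → Carrier
  elem = Inverse.to enumeration

  index : Carrier → Fin q
  index = Inverse.from enumeration

  elem-index : ∀ x → elem (index x) ≡ x
  elem-index = Inverse.strictlyInverseˡ enumeration

  index-elem : ∀ i → index (elem i) ≡ i
  index-elem = Inverse.strictlyInverseʳ enumeration

  infix 4 _≟_
  _≟_ : DecidableEquality Carrier
  x ≟ y = map′ (λ e → trans (sym (elem-index x)) (trans (cong elem e) (elem-index y)))
               (cong index) (index x Fin.≟ index y)

  -- Extended by 0⁻¹ = 0.
  infix 9 _⁻¹
  _⁻¹ : Carrier → Carrier
  x ⁻¹ with x ≟ 0#
  ... | yes _   = 0#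
  ... | no  x≢0 = proj₁ (invertible x x≢0)

  infixr 8 _^ᶻ_
  _^ᶻ_ : Carrier → ℤ → Carrier
  x ^ᶻ (+ t)    = x ^ t
  x ^ᶻ -[1+ t ] = (x ⁻¹) ^ suc t

  Σ𝔽 : (Carrier → ℤ) → ℤ
  Σ𝔽 f = Integer.sum (λ i → f (elem i))

  record IsCyclicSubgroupOfOrder (d : ℕ) (U : Pred Carrier 0ℓ) : Set where
    field
      generator   : Carrier
      generator≢0 : generator ≢ 0#
      generates   : ∀ u → U u ⇔ (∃[ i ] u ≡ generator ^ᶻ i)
      element     : Fin d → Carrier
      distinct    : Injective _≡_ _≡_ element
      exhaustive  : ∀ u → U u ⇔ (∃[ j ] u ≡ element j)

  *-cancelˡ : ∀ {x} → x ≢ 0# → ∀ {y z} → x * y ≡ x * z → y ≡ z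
  *-cancelˡ {x} x≢0 {y} {z} e = trans (sym (lem y)) (trans (cong (x′ *_) e) (lem z))
    where
    x′ = proj₁ (invertible x x≢0)
    lem : ∀ w → x′ * (x * w) ≡ w
    lem w = trans (sym (*-assoc _ _ _))
              (trans (cong (_* w) (trans (*-comm _ _) (proj₂ (invertible x x≢0)))) (*-identityˡ w))

  *-≢0 : ∀ {x y} → x ≢ 0# → y ≢ 0# → x * y ≢ 0#
  *-≢0 {x} x≢0 y≢0 e = y≢0 (*-cancelˡ x≢0 (trans e (sym (zeroʳ x))))

  private
    permutation : (φ ψ : Carrier → Carrier) → (∀ x → φ (ψ x) ≡ x) → (∀ x → ψ (φ x) ≡ x) → Permutation q q
    permutation φ ψ φψ ψφ = mk↔ₛ′ (index ∘ φ ∘ elem) (index ∘ ψ ∘ elem) (inv φ ψ φψ) (inv ψ φ ψφ)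
      where
      inv : (f g : Carrier → Carrier) → (∀ x → f (g x) ≡ x) → ∀ i → index (f (elem (index (g (elem i))))) ≡ i
      inv f g fg i = trans (cong (index ∘ f) (elem-index _)) (trans (cong index (fg _)) (index-elem i))

    ∑-single : ∀ {r} (f : Fin r → Carrier) (i : Fin r) → (∀ j → j ≢ i → f j ≡ 1#) → Multiplicative.sum f ≡ f i
    ∑-single {suc r} f i e = begin
      Multiplicative.sum f                         ≡⟨ Multiplicative.sum-remove {i = i} f ⟩
      f i * Multiplicative.sum (removeAt f i)      ≡⟨ cong (f i *_) (Multiplicative.sum-cong-≗ {r} (λ j → e (punchIn i j) (Fin.punchInᵢ≢i i j))) ⟩
      f i * Multiplicative.sum {r} (λ _ → 1#)      ≡⟨ cong (f i *_) (Multiplicative.sum-replicate-zero r) ⟩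
      f i * 1#                                     ≡⟨ *-identityʳ _ ⟩
      f i                                          ∎
      where open ≡-Reasoning

    ∏-≢0 : ∀ {r} (f : Fin r → Carrier) → (∀ i → f i ≢ 0#) → Multiplicative.sum f ≢ 0#
    ∏-≢0 {zero}  f e = 0≢1 ∘ sym
    ∏-≢0 {suc r} f e = *-≢0 (e zero) (∏-≢0 (f ∘ suc) (e ∘ suc))

    ∏-const : ∀ r a → Multiplicative.sum {r} (λ _ → a) ≡ a ^ r
    ∏-const zero    a = refl
    ∏-const (suc r) a = cong (a *_) (∏-const r a)

    orOne : Carrier → Carrier
    orOne x with x ≟ 0#
    ... | yes _ = 1#
    ... | no  _ = x

    orOne≢0 : ∀ x → orOne x ≢ 0#
    orOne≢0 x with x ≟ 0#
    ... | yes _   = 0≢1 ∘ sym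
    ... | no  x≢0 = x≢0

  0^suc : ∀ r → 0# ^ suc r ≡ 0#
  0^suc r = zeroˡ _

  1^ : ∀ r → 1# ^ r ≡ 1#
  1^ zero    = refl
  1^ (suc r) = trans (*-identityˡ _) (1^ r)

  private
    fermat≢0 : ∀ a → a ≢ 0# → a ^ q ≡ a
    fermat≢0 a a≢0 = *-cancelˡ (∏-≢0 (orOne ∘ elem) (orOne≢0 ∘ elem)) (begin
      P * a ^ q                          ≡⟨ cong (P *_) (∏-const q a) ⟨
      P * M.sum {q} (λ _ → a)            ≡⟨ M.∑-distrib-+ (orOne ∘ elem) (λ _ → a) ⟨
      M.sum (λ i → orOne (elem i) * a)   ≡⟨ M.sum-cong-≗ {q} (λ i → step (elem i)) ⟩
      M.sum (λ i → orOne (a * elem i) * δ (elem i))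
                                         ≡⟨ M.∑-distrib-+ (λ i → orOne (a * elem i)) (δ ∘ elem) ⟩
      M.sum (λ i → orOne (a * elem i)) * M.sum (δ ∘ elem)
                                         ≡⟨ cong₂ _*_ shift single ⟩
      P * a                              ∎)
      where
      open ≡-Reasoning
      module M = Multiplicative
      P = M.sum (orOne ∘ elem)
      a′ = proj₁ (invertible a a≢0)
      δ : Carrier → Carrier
      δ x with x ≟ 0#
      ... | yes _ = a
      ... | no  _ = 1#
      δ0 : δ 0# ≡ a
      δ0 with 0# ≟ 0#
      ... | yes _ = refl
      ... | no  n = ⊥-elim (n refl)
      δ≢0 : ∀ x → x ≢ 0# → δ x ≡ 1#
      δ≢0 x x≢0 with x ≟ 0#
      ... | yes e = ⊥-elim (x≢0 e)
      ... | no  _ = refl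
      step : ∀ x → orOne x * a ≡ orOne (a * x) * δ x
      step x with x ≟ 0# | a * x ≟ 0#
      ... | yes _    | yes _ = refl
      ... | yes refl | no  n = ⊥-elim (n (zeroʳ a))
      ... | no  x≢0  | yes e = ⊥-elim (*-≢0 a≢0 x≢0 e)
      ... | no  _    | no  _ = trans (*-comm x a) (sym (*-identityʳ _))
      cancel : ∀ {b c} → b * c ≡ 1# → ∀ x → b * (c * x) ≡ x
      cancel e x = trans (sym (*-assoc _ _ _)) (trans (cong (_* x) e) (*-identityˡ x))
      shift : M.sum (λ i → orOne (a * elem i)) ≡ P
      shift = sym (trans (M.sum-permute (orOne ∘ elem)
          (permutation (a *_) (a′ *_) (cancel (proj₂ (invertible a a≢0)))
             (cancel (trans (*-comm _ _) (proj₂ (invertible a a≢0))))))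
        (M.sum-cong-≗ {q} (λ i → cong orOne (elem-index (a * elem i)))))
      single : M.sum (δ ∘ elem) ≡ a
      single = trans (∑-single (δ ∘ elem) (index 0#)
          (λ j j≢ → δ≢0 _ (λ e → j≢ (trans (sym (index-elem j)) (cong index e)))))
        (trans (cong δ (elem-index 0#)) δ0)

    0^q : ∀ {r} → Fin r → 0# ^ r ≡ 0#
    0^q {suc r} _ = 0^suc r

  fermat : ∀ a → a ^ q ≡ a
  fermat a with a ≟ 0#
  ... | yes refl = 0^q (index 0#)
  ... | no  a≢0  = fermat≢0 a a≢0

  open Mult semiring using () renaming (_×_ to _·_)

  card·1≡0 : q · 1# ≡ 0#
  card·1≡0 = RingProperties.+-cancelˡ ring S (q · 1#) 0# (begin
    S + q · 1#                     ≡⟨ cong (λ z → S + z) (Additive.sum-replicate q) ⟨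
    S + Additive.sum {q} (λ _ → 1#) ≡⟨ Additive.∑-distrib-+ elem (λ _ → 1#) ⟨
    Additive.sum (λ i → elem i + 1#) ≡⟨ Additive.sum-cong-≗ {q} (λ i → elem-index (elem i + 1#)) ⟨
    Additive.sum (λ i → elem (index (elem i + 1#)))
      ≡⟨ Additive.sum-permute elem (permutation (_+ 1#) (_+ - 1#) (cancel (-‿inverseˡ 1#)) (cancel (-‿inverseʳ 1#))) ⟨
    S                              ≡⟨ +-identityʳ S ⟨
    S + 0#                         ∎)
    where
    open ≡-Reasoning
    S = Additive.sum elem
    cancel : ∀ {b c} → b + c ≡ 0# → ∀ x → (x + b) + c ≡ x
    cancel {b} {c} e x = trans (+-assoc x b c) (trans (cong (λ z → x + z) e) (+-identityʳ x))

module BinaryField {n : ℕ} (K : FiniteField (2 ℕ.^ n)) where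
  open FieldOps K public
  open FiniteField K using (commutativeRing)
  private module R = CommutativeRing commutativeRing
  open Mult R.semiring using (×1-homo-*) renaming (_×_ to _·_)

  1+1≡0 : 1# + 1# ≡ 0#
  1+1≡0 = trans (cong (λ z → 1# + z) (sym (+-identityʳ 1#))) (go n card·1≡0)
    where
    open FiniteField K using (0≢1)
    go : ∀ r → (2 ℕ.^ r) · 1# ≡ 0# → 2 · 1# ≡ 0#
    go zero    e = ⊥-elim (0≢1 (sym (trans (sym (+-identityʳ 1#)) e)))
    go (suc r) e with 2 · 1# ≟ 0#
    ... | yes p = p
    ... | no  p = go r (*-cancelˡ p (trans (trans (sym (×1-homo-* 2 (2 ℕ.^ r))) e) (sym (zeroʳ _))))

  x+x≡0 : ∀ x → x + x ≡ 0#
  x+x≡0 x = begin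
    x + x             ≡⟨ cong₂ _+_ (*-identityʳ x) (*-identityʳ x) ⟨
    x * 1# + x * 1#   ≡⟨ distribˡ x 1# 1# ⟨
    x * (1# + 1#)     ≡⟨ cong (x *_) 1+1≡0 ⟩
    x * 0#            ≡⟨ zeroʳ x ⟩
    0#                ∎
    where open ≡-Reasoning

  ^2 : ∀ x → x ^ 2 ≡ x * x
  ^2 x = cong (x *_) (*-identityʳ x)

  square-+ : ∀ x y → (x + y) ^ 2 ≡ x ^ 2 + y ^ 2
  square-+ x y = begin
    (x + y) ^ 2                         ≡⟨ ^2 (x + y) ⟩
    (x + y) * (x + y)                   ≡⟨ distribˡ (x + y) x y ⟩
    (x + y) * x + (x + y) * y           ≡⟨ cong₂ _+_ (distribʳ x x y) (distribʳ y x y) ⟩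
    (x * x + y * x) + (x * y + y * y)   ≡⟨ +-assoc _ _ _ ⟩
    x * x + (y * x + (x * y + y * y))   ≡⟨ cong (λ z → x * x + z) (+-assoc _ _ _) ⟨
    x * x + ((y * x + x * y) + y * y)   ≡⟨ cong (λ z → x * x + ((y * x + z) + y * y)) (*-comm x y) ⟩
    x * x + ((y * x + y * x) + y * y)   ≡⟨ cong (λ z → x * x + (z + y * y)) (x+x≡0 _) ⟩
    x * x + (0# + y * y)                ≡⟨ cong (λ z → x * x + z) (+-identityˡ _) ⟩
    x * x + y * y                       ≡⟨ cong₂ _+_ (^2 x) (^2 y) ⟨
    x ^ 2 + y ^ 2                       ∎
    where open ≡-Reasoning

  frobenius-+ : ∀ r x y → (x + y) ^ (2 ℕ.^ r) ≡ x ^ (2 ℕ.^ r) + y ^ (2 ℕ.^ r)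
  frobenius-+ zero    x y = trans (*-identityʳ _) (sym (cong₂ _+_ (*-identityʳ x) (*-identityʳ y)))
  frobenius-+ (suc r) x y = begin
    (x + y) ^ (2 ℕ.* Q)           ≡⟨ ^-assocʳ (x + y) 2 Q ⟨
    ((x + y) ^ 2) ^ Q             ≡⟨ cong (_^ Q) (square-+ x y) ⟩
    (x ^ 2 + y ^ 2) ^ Q           ≡⟨ frobenius-+ r (x ^ 2) (y ^ 2) ⟩
    (x ^ 2) ^ Q + (y ^ 2) ^ Q     ≡⟨ cong₂ _+_ (^-assocʳ x 2 Q) (^-assocʳ y 2 Q) ⟩
    x ^ (2 ℕ.* Q) + y ^ (2 ℕ.* Q) ∎
    where
    open ≡-Reasoning
    Q = 2 ℕ.^ r

  0^2^ : ∀ r → 0# ^ (2 ℕ.^ r) ≡ 0#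
  0^2^ zero    = *-identityʳ 0#
  0^2^ (suc r) = trans (sym (^-assocʳ 0# 2 (2 ℕ.^ r))) (trans (cong (_^ (2 ℕ.^ r)) (0^suc 1)) (0^2^ r))

  fromBool : Bool → Carrier
  fromBool false = 0#
  fromBool true  = 1#

  traceSum : Carrier → Carrier
  traceSum y = Additive.sum {n} (λ i → y ^ (2 ℕ.^ toℕ i))

  -- The absolute trace as an element of 𝔽₂; Tr₁-correct shows that no
  -- value of traceSum other than 0 and 1 is being collapsed here.
  Tr₁ : Carrier → Bool
  Tr₁ y with traceSum y ≟ 0#
  ... | yes _ = false
  ... | no  _ = true

  private
    square-sum : ∀ {r} (f : Fin r → Carrier) → Additive.sum f ^ 2 ≡ Additive.sum (λ i → f i ^ 2)
    square-sum {zero}  f = 0^suc 1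
    square-sum {suc r} f = trans (square-+ _ _) (cong (λ z → f zero ^ 2 + z) (square-sum (f ∘ suc)))

    telescope : ∀ r (g : ℕ → Carrier) →
                g 0 + Additive.sum {r} (λ i → g (suc (toℕ i))) ≡ Additive.sum {r} (λ i → g (toℕ i)) + g r
    telescope zero    g = +-comm _ _
    telescope (suc r) g = trans (cong (λ z → g 0 + z) (telescope r (g ∘ suc))) (sym (+-assoc _ _ _))

    traceSum² : ∀ y → traceSum y ^ 2 ≡ traceSum y
    traceSum² y = begin
      traceSum y ^ 2                               ≡⟨ square-sum {n} (λ i → g (toℕ i)) ⟩
      Additive.sum {n} (λ i → g (toℕ i) ^ 2)       ≡⟨ Additive.sum-cong-≗ {n} (λ i → step (toℕ i)) ⟩
      Additive.sum {n} (λ i → g (suc (toℕ i)))     ≡⟨ RingProperties.+-cancelˡ R.ring (g 0) _ _ shift ⟩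
      traceSum y                                   ∎
      where
      open ≡-Reasoning
      g : ℕ → Carrier
      g i = y ^ (2 ℕ.^ i)
      step : ∀ i → g i ^ 2 ≡ g (suc i)
      step i = trans (^-assocʳ y (2 ℕ.^ i) 2) (cong (y ^_) (ℕ.*-comm (2 ℕ.^ i) 2))
      shift : g 0 + Additive.sum {n} (λ i → g (suc (toℕ i))) ≡ g 0 + traceSum y
      shift = trans (telescope n g) (trans (+-comm _ _)
                (cong (_+ traceSum y) (trans (fermat y) (sym (*-identityʳ y)))))

  Tr₁-correct : ∀ y → fromBool (Tr₁ y) ≡ traceSum y
  Tr₁-correct y with traceSum y ≟ 0#
  ... | yes e = sym e
  ... | no ne = sym (*-cancelˡ ne (trans (sym (^2 _)) (trans (traceSum² y) (sym (*-identityʳ _)))))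

module QuadraticExtension (m : ℕ) (K : FiniteField (2 ℕ.^ (2 ℕ.* m))) where
  open BinaryField {2 ℕ.* m} K public

  -- 𝔽_{2^m} as the subfield of 𝔽_{2^(2m)} fixed by y ↦ y^(2^m).
  Subfield : Set
  Subfield = Σ Carrier (λ y → y ^ (2 ℕ.^ m) ≡ y)

  0ₛ : Subfield
  0ₛ = 0# , 0^2^ m

  Trₘ : Carrier → Subfield
  Trₘ y = y + y ^ Q , (begin
    (y + y ^ Q) ^ Q           ≡⟨ frobenius-+ m y (y ^ Q) ⟩
    y ^ Q + (y ^ Q) ^ Q       ≡⟨ cong (λ z → y ^ Q + z) (^-assocʳ y Q Q) ⟩
    y ^ Q + y ^ (Q ℕ.* Q)     ≡⟨ cong (λ z → y ^ Q + y ^ z) Q*Q ⟩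
    y ^ Q + y ^ (2 ℕ.^ (2 ℕ.* m)) ≡⟨ cong (λ z → y ^ Q + z) (fermat y) ⟩
    y ^ Q + y                 ≡⟨ +-comm _ _ ⟩
    y + y ^ Q                 ∎)
    where
    open ≡-Reasoning
    Q = 2 ℕ.^ m
    Q*Q : Q ℕ.* Q ≡ 2 ℕ.^ (2 ℕ.* m)
    Q*Q = trans (sym (ℕ.^-distribˡ-+-* 2 m m)) (cong (λ z → 2 ℕ.^ (m ℕ.+ z)) (sym (ℕ.+-identityʳ m)))

  T : Carrier → Carrier → Subfield
  T u x = Trₘ (u * Additive.sum {2 ℕ.^ (m ∸ 1)} (λ i → x ^ (suc (toℕ i) ℕ.* (2 ℕ.^ m ∸ 1))))

  -- Every fibre has 2^(m-k) elements; the condition N · 2^k = 2^m reads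
  -- this off correctly (as unsatisfiable) when k > m.
  Balanced : ∀ {k} → (Subfield → 𝔽₂^ k) → Set
  Balanced {k} h = ∀ b → ∃[ N ] (N ℕ.* 2 ℕ.^ k ≡ 2 ℕ.^ m) × (Fin N ↔ (∃[ y ] h y ≡ b))

  HyperBent : (Carrier → Bool) → Set
  HyperBent f = ∀ (c : Carrier) (t : ℤ) → ℤ.gcd t (+ (2 ℕ.^ (2 ℕ.* m) ∸ 1)) ≡ 1ℤ →
                let W = Σ𝔽 (λ x → -1^ (f x xor Tr₁ (c * x ^ᶻ t)))
                in W ≡ + (2 ℕ.^ m) ⊎ W ≡ ℤ.- (+ (2 ℕ.^ m))

  VectorialHyperBent : ∀ {k} → (Carrier → 𝔽₂^ k) → Set
  VectorialHyperBent F = ∀ v → v ≢ 𝟎 → HyperBent (λ x → ⟨ v , F x ⟩)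

{-# OPTIONS --safe #-}

-- Put Q = 2^m, write conj x = x^Q and tr x = x + conj x, and let
-- F(x) = (-1)^⟨v , h (T u₀ x)⟩. Summing the geometric progression gives
--     T u₀ ((conj X)²) = tr (u₀ X) / tr X      whenever tr X ≠ 0,
-- and for e ∈ 𝔽_Q the involution X ↦ X + (e / tr u₀) tr X translates this value by e
-- (tr u₀ ≠ 0 because u₀ ≠ 1 has norm 1). Since h is balanced, averaging over e shows
-- that the X outside 𝔽_Q contribute 0 to Σ F, while F = 1 on 𝔽_Q; hence Σ F = Q.
-- For c ≠ 0 the substitution x = (x′/c)^s, where s t ≡ 1 mod Q² - 1, turns the Walsh sum
-- into Σ G(x) χ(x) with G again invariant under 𝔽_Q^* and Σ G = Q. Evaluating
-- Σ_{y ∈ 𝔽_Q} Σ_x G(x) χ(xy) in both orders gives (Q - 1) Σ G χ = (Q - 1) Q G(1).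
module Submission where

open import Algebra.Bundles using (CommutativeRing)
import Algebra.Properties.Semiring.Sum as SemiringSum
import Algebra.Solver.Ring.NaturalCoefficients.Default as SemiringSolver
open import Axiom.UniquenessOfIdentityProofs.WithK using () renaming (uip to ≡-irrelevant)
open import Data.Bool.Base using (Bool; true; false; not; _xor_)
import Data.Bool.Properties as Bool
open import Data.Empty using (⊥-elim)
open import Data.Fin.Base using (Fin; zero; suc; toℕ; punchIn)
open import Data.Fin.Permutation using (Permutation)
import Data.Fin.Properties as Fin
open import Data.Integer.Base as ℤ using (ℤ; +_; -[1+_]; 0ℤ; 1ℤ; -1ℤ)
import Data.Integer.GCD as ℤ
import Data.Integer.Properties as ℤ
open import Data.Integer.Tactic.RingSolver using () renaming (solve-∀ to ℤ-solve-∀)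
open import Data.Nat.Base as ℕ using (ℕ; zero; suc; _∸_; _≤_; z≤n; s≤s)
open import Data.Nat.Coprimality using (Coprime; coprime-Bézout; gcd≡1⇒coprime)
open import Data.Nat.GCD using (module Bézout)
import Data.Nat.Properties as ℕ
open import Data.Nat.Tactic.RingSolver using () renaming (solve-∀ to ℕ-solve-∀)
open import Data.Product.Base using (∃₂; ∃-syntax; _×_; _,_; proj₁; proj₂)
open import Data.Sum.Base as Sum using (_⊎_; inj₁; inj₂)
open import Data.Vec.Base using ([]; _∷_)
open import Data.Vec.Functional using (removeAt)
open import Data.Vec.Properties using (≡-dec)
open import Function.Base using (_∘_)
open import Function.Bundles using (Inverse; Equivalence; _↔_; mk↔ₛ′)
open import Relation.Binary.Definitions using (DecidableEquality)
open import Relation.Binary.PropositionalEquality using (_≡_; _≢_; refl; sym; trans; cong; cong₂; subst; module ≡-Reasoning)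
open import Relation.Nullary using (Dec; yes; no; ¬_)
open import Defs

open ≡-Reasoning

-- Replacing x by `(conj X)²` makes the ratio of the progression a square `z²`. The progression has
-- Q/2 terms, so its last power is `z^Q = conj z`, and the closed form turns into a fraction with
-- denominator `tr X`. This denominator lies in 𝔽_Q and can be moved through the relative trace. The
-- bound m ≥ 2 is a genuine restriction. For m = 1 the progression is the single term x, so `h ∘ T`
-- is linear and hence not bent. In the proof the bound makes Q/2 even, which is why `T` vanishes on
-- 𝔽_Q. Hyper-bentness costs no more than bentness: s-th powers map 𝔽_Q^* into itself, so invariance
-- under scaling by 𝔽_Q^* survives the substitution that removes the exponent t.

module ∑ = SemiringSum ℤ.+-*-semiring

-- Iverson brackets, integer sums and signs

[_] : ∀ {a} {A : Set a} → Dec A → ℤ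
[ yes _ ] = 1ℤ
[ no  _ ] = 0ℤ

[]-yes : ∀ {a} {A : Set a} (d : Dec A) → A → [ d ] ≡ 1ℤ
[]-yes (yes _) _ = refl
[]-yes (no ¬a) a = ⊥-elim (¬a a)

[]-no : ∀ {a} {A : Set a} (d : Dec A) → ¬ A → [ d ] ≡ 0ℤ
[]-no (yes a) ¬a = ⊥-elim (¬a a)
[]-no (no _)  _  = refl

[]-cong : ∀ {a b} {A : Set a} {B : Set b} → (A → B) → (B → A) → (d : Dec A) (e : Dec B) → [ d ] ≡ [ e ]
[]-cong f g (yes a) e = sym ([]-yes e (f a))
[]-cong f g (no ¬a) e = sym ([]-no e (λ b → ¬a (g b)))

sum-single : ∀ {r} (f : Fin r → ℤ) (i : Fin r) → (∀ j → j ≢ i → f j ≡ 0ℤ) → ∑.sum f ≡ f i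
sum-single {suc r} f i e = begin
  ∑.sum f                         ≡⟨ ∑.sum-remove {i = i} f ⟩
  f i ℤ.+ ∑.sum (removeAt f i)    ≡⟨ cong (λ z → f i ℤ.+ z) (∑.sum-cong-≗ {r} (λ j → e (punchIn i j) (Fin.punchInᵢ≢i i j))) ⟩
  f i ℤ.+ ∑.sum {r} (λ _ → 0ℤ)    ≡⟨ cong (λ z → f i ℤ.+ z) (∑.sum-replicate-zero r) ⟩
  f i ℤ.+ 0ℤ                      ≡⟨ ℤ.+-identityʳ _ ⟩
  f i                             ∎

sum-1 : ∀ r → ∑.sum {r} (λ _ → 1ℤ) ≡ + r
sum-1 zero    = refl
sum-1 (suc r) = cong (λ z → 1ℤ ℤ.+ z) (sum-1 r)

-1^-xor : ∀ a b → -1^ (a xor b) ≡ -1^ a ℤ.* -1^ b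
-1^-xor false false = refl
-1^-xor false true  = refl
-1^-xor true  false = refl
-1^-xor true  true  = refl

i≡-i⇒i≡0 : ∀ i → i ≡ ℤ.- i → i ≡ 0ℤ
i≡-i⇒i≡0 (+ zero) _ = refl

-- Sums over 𝔽₂^k

_≟₂_ : ∀ {k} → DecidableEquality (𝔽₂^ k)
_≟₂_ = ≡-dec Bool._≟_

-- Recursion on the bits turns orthogonality of characters into an induction on k.
∑₂ : ∀ {k} → (𝔽₂^ k → ℤ) → ℤ
∑₂ {zero}  φ = φ []
∑₂ {suc k} φ = ∑₂ (λ b → φ (false ∷ b)) ℤ.+ ∑₂ (λ b → φ (true ∷ b))

∑₂-cong : ∀ {k} {φ ψ : 𝔽₂^ k → ℤ} → (∀ b → φ b ≡ ψ b) → ∑₂ φ ≡ ∑₂ ψ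
∑₂-cong {zero}  e = e []
∑₂-cong {suc k} e = cong₂ ℤ._+_ (∑₂-cong (λ b → e (false ∷ b))) (∑₂-cong (λ b → e (true ∷ b)))

∑₂-0 : ∀ k → ∑₂ {k} (λ _ → 0ℤ) ≡ 0ℤ
∑₂-0 zero    = refl
∑₂-0 (suc k) = cong₂ ℤ._+_ (∑₂-0 k) (∑₂-0 k)

∑₂-1 : ∀ k → ∑₂ {k} (λ _ → 1ℤ) ≡ + (2 ℕ.^ k)
∑₂-1 zero    = refl
∑₂-1 (suc k) = begin
  ∑₂ {k} (λ _ → 1ℤ) ℤ.+ ∑₂ {k} (λ _ → 1ℤ)   ≡⟨ cong₂ ℤ._+_ (∑₂-1 k) (∑₂-1 k) ⟩
  + (2 ℕ.^ k ℕ.+ 2 ℕ.^ k)                   ≡⟨ cong (λ z → + (2 ℕ.^ k ℕ.+ z)) (ℕ.+-identityʳ (2 ℕ.^ k)) ⟨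
  + (2 ℕ.^ suc k)                           ∎

∑₂-*ˡ : ∀ {k} a (φ : 𝔽₂^ k → ℤ) → a ℤ.* ∑₂ φ ≡ ∑₂ (λ b → a ℤ.* φ b)
∑₂-*ˡ {zero}  a φ = refl
∑₂-*ˡ {suc k} a φ = trans
  (ℤ.*-distribˡ-+ a (∑₂ (λ b → φ (false ∷ b))) (∑₂ (λ b → φ (true ∷ b))))
  (cong₂ ℤ._+_ (∑₂-*ˡ a (λ b → φ (false ∷ b))) (∑₂-*ˡ a (λ b → φ (true ∷ b))))

-- Sifting by a Kronecker delta. It splits `φ (h y)` according to the value of `h`, which lets the
-- fibre sizes of a balanced function enter.
∑₂-select : ∀ {k} (φ : 𝔽₂^ k → ℤ) w → ∑₂ (λ b → φ b ℤ.* [ w ≟₂ b ]) ≡ φ w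
∑₂-select {zero}  φ []          = ℤ.*-identityʳ _
∑₂-select {suc k} φ (false ∷ w) = begin
  _ ≡⟨ cong₂ ℤ._+_
        (∑₂-cong (λ b → cong (φ (false ∷ b) ℤ.*_) ([]-cong (λ { refl → refl }) (cong (false ∷_)) ((false ∷ w) ≟₂ (false ∷ b)) (w ≟₂ b))))
        (trans (∑₂-cong (λ b → trans (cong (φ (true ∷ b) ℤ.*_) ([]-no ((false ∷ w) ≟₂ (true ∷ b)) (λ ()))) (ℤ.*-zeroʳ (φ (true ∷ b))))) (∑₂-0 k)) ⟩
  _ ≡⟨ ℤ.+-identityʳ _ ⟩
  _ ≡⟨ ∑₂-select (λ b → φ (false ∷ b)) w ⟩
  _ ∎
∑₂-select {suc k} φ (true ∷ w) = begin
  _ ≡⟨ cong₂ ℤ._+_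
        (trans (∑₂-cong (λ b → trans (cong (φ (false ∷ b) ℤ.*_) ([]-no ((true ∷ w) ≟₂ (false ∷ b)) (λ ()))) (ℤ.*-zeroʳ (φ (false ∷ b))))) (∑₂-0 k))
        (∑₂-cong (λ b → cong (φ (true ∷ b) ℤ.*_) ([]-cong (λ { refl → refl }) (cong (true ∷_)) ((true ∷ w) ≟₂ (true ∷ b)) (w ≟₂ b)))) ⟩
  _ ≡⟨ ℤ.+-identityˡ _ ⟩
  _ ≡⟨ ∑₂-select (λ b → φ (true ∷ b)) w ⟩
  _ ∎

-- Flipping a bit of `b` at which `v` is `true` changes the sign, so the two halves cancel there. A
-- leading `false` doubles a sum that vanishes by induction.
∑₂-character : ∀ {k} (v : 𝔽₂^ k) → v ≢ 𝟎 → ∑₂ (λ b → -1^ ⟨ v , b ⟩) ≡ 0ℤ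
∑₂-character []          v≢0 = ⊥-elim (v≢0 refl)
∑₂-character (false ∷ v) v≢0 = cong₂ ℤ._+_ ih ih
  where ih = ∑₂-character v (λ e → v≢0 (cong (false ∷_) e))
∑₂-character (true ∷ v)  v≢0 = begin
  S ℤ.+ ∑₂ (λ b → -1^ (not ⟨ v , b ⟩))     ≡⟨ cong (λ z → S ℤ.+ z) (∑₂-cong (λ b → -1^-xor true ⟨ v , b ⟩)) ⟩
  S ℤ.+ ∑₂ (λ b → -1ℤ ℤ.* -1^ ⟨ v , b ⟩)   ≡⟨ cong (λ z → S ℤ.+ z) (∑₂-*ˡ -1ℤ (λ b → -1^ ⟨ v , b ⟩)) ⟨
  S ℤ.+ -1ℤ ℤ.* S                          ≡⟨ cong (λ z → S ℤ.+ z) (ℤ.-1*i≡-i S) ⟩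
  S ℤ.+ ℤ.- S                              ≡⟨ ℤ.+-inverseʳ S ⟩
  0ℤ                                       ∎
  where S = ∑₂ (λ b → -1^ ⟨ v , b ⟩)

⟨-,𝟎⟩ : ∀ {k} (v : 𝔽₂^ k) → ⟨ v , 𝟎 ⟩ ≡ false
⟨-,𝟎⟩ []          = refl
⟨-,𝟎⟩ (false ∷ v) = ⟨-,𝟎⟩ v
⟨-,𝟎⟩ (true ∷ v)  = ⟨-,𝟎⟩ v

-- Sums over a finite field

module FieldSums {q : ℕ} (K : FiniteField q) where
  open FieldOps K

  Σ-cong : ∀ {f g : Carrier → ℤ} → (∀ x → f x ≡ g x) → Σ𝔽 f ≡ Σ𝔽 g
  Σ-cong e = ∑.sum-cong-≗ {q} (λ i → e (elem i))

  Σ-+ : ∀ f g → Σ𝔽 (λ x → f x ℤ.+ g x) ≡ Σ𝔽 f ℤ.+ Σ𝔽 g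
  Σ-+ f g = ∑.∑-distrib-+ {q} (λ i → f (elem i)) (λ i → g (elem i))

  Σ-0 : Σ𝔽 (λ _ → 0ℤ) ≡ 0ℤ
  Σ-0 = ∑.sum-replicate-zero q

  Σ-*ˡ : ∀ a f → a ℤ.* Σ𝔽 f ≡ Σ𝔽 (λ x → a ℤ.* f x)
  Σ-*ˡ a f = ∑.*-distribˡ-sum {q} a (λ i → f (elem i))

  Σ-*ʳ : ∀ a f → Σ𝔽 f ℤ.* a ≡ Σ𝔽 (λ x → f x ℤ.* a)
  Σ-*ʳ a f = ∑.*-distribʳ-sum {q} a (λ i → f (elem i))

  Σ-swap : ∀ (f : Carrier → Carrier → ℤ) → Σ𝔽 (λ x → Σ𝔽 (f x)) ≡ Σ𝔽 (λ y → Σ𝔽 (λ x → f x y))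
  Σ-swap f = ∑.∑-comm {q} {q} (λ i j → f (elem i) (elem j))

  Σ-reindex : (φ ψ : Carrier → Carrier) → (∀ x → φ (ψ x) ≡ x) → (∀ x → ψ (φ x) ≡ x) →
              ∀ f → Σ𝔽 f ≡ Σ𝔽 (λ x → f (φ x))
  Σ-reindex φ ψ φψ ψφ f = trans (∑.sum-permute {q} {q} (λ i → f (elem i)) π)
      (∑.sum-cong-≗ {q} (λ i → cong f (elem-index (φ (elem i)))))
    where
    inv : (f g : Carrier → Carrier) → (∀ x → f (g x) ≡ x) → ∀ i → index (f (elem (index (g (elem i))))) ≡ i
    inv f g fg i = trans (cong (index ∘ f) (elem-index _)) (trans (cong index (fg _)) (index-elem i))
    π : Permutation q q
    π = mk↔ₛ′ (index ∘ φ ∘ elem) (index ∘ ψ ∘ elem) (inv φ ψ φψ) (inv ψ φ ψφ)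

  Σ-single : ∀ f a → (∀ x → x ≢ a → f x ≡ 0ℤ) → Σ𝔽 f ≡ f a
  Σ-single f a e = trans
    (sum-single {q} (λ i → f (elem i)) (index a) (λ j j≢ → e _ (λ p → j≢ (trans (sym (index-elem j)) (cong index p)))))
    (cong f (elem-index a))

  Σ-δ : ∀ a c → Σ𝔽 (λ x → [ x ≟ a ] ℤ.* c) ≡ c
  Σ-δ a c = begin
    Σ𝔽 (λ x → [ x ≟ a ] ℤ.* c) ≡⟨ Σ-single _ a (λ x x≢a → cong (ℤ._* c) ([]-no (x ≟ a) x≢a)) ⟩
    [ a ≟ a ] ℤ.* c            ≡⟨ cong (ℤ._* c) ([]-yes (a ≟ a) refl) ⟩
    1ℤ ℤ.* c                   ≡⟨ ℤ.*-identityˡ c ⟩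
    c                          ∎

  Σ-∑₂ : ∀ {k} (f : Carrier → 𝔽₂^ k → ℤ) → Σ𝔽 (λ x → ∑₂ (f x)) ≡ ∑₂ (λ b → Σ𝔽 (λ x → f x b))
  Σ-∑₂ {zero}  f = refl
  Σ-∑₂ {suc k} f = trans
    (Σ-+ (λ x → ∑₂ (λ b → f x (false ∷ b))) (λ x → ∑₂ (λ b → f x (true ∷ b))))
    (cong₂ ℤ._+_ (Σ-∑₂ (λ x b → f x (false ∷ b))) (Σ-∑₂ (λ x b → f x (true ∷ b))))

-- Powers in a finite field

-- Bézout over ℕ comes with two signs. Either `s * t` is already 1 modulo N, or it is -1 and
-- `s * t * s` is the inverse instead; in the latter case `s * t = 0` would make N divide 1.
inverse-mod : ∀ t N → N ≢ 1 → Coprime t N → ∃₂ λ s k → s ℕ.* t ≡ suc (k ℕ.* N)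
inverse-mod t N N≢1 c with coprime-Bézout c
... | Bézout.+- s k e = s , k , sym e
... | Bézout.-+ s k e = (s ℕ.* t) ℕ.* s , aux (s ℕ.* t) refl e
  where
  -- If a ≡ -1 (mod N), then a² ≡ 1.
  aux : ∀ a → a ≡ s ℕ.* t → 1 ℕ.+ a ≡ k ℕ.* N → ∃[ l ] (s ℕ.* t) ℕ.* s ℕ.* t ≡ suc (l ℕ.* N)
  aux zero    _  e = ⊥-elim (N≢1 (ℕ.m*n≡1⇒n≡1 k N (sym e)))
  aux (suc b) a≡ e = b ℕ.* k , (begin
    (s ℕ.* t) ℕ.* s ℕ.* t      ≡⟨ ℕ.*-assoc (s ℕ.* t) s t ⟩
    (s ℕ.* t) ℕ.* (s ℕ.* t)    ≡⟨ cong₂ ℕ._*_ a≡ a≡ ⟨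
    suc b ℕ.* suc b            ≡⟨ square b ⟩
    suc (b ℕ.* (1 ℕ.+ suc b))  ≡⟨ cong (λ z → suc (b ℕ.* z)) e ⟩
    suc (b ℕ.* (k ℕ.* N))      ≡⟨ cong suc (ℕ.*-assoc b k N) ⟨
    suc (b ℕ.* k ℕ.* N)        ∎)
    where
    square : ∀ b → suc b ℕ.* suc b ≡ suc (b ℕ.* (1 ℕ.+ suc b))
    square = ℕ-solve-∀

module Powers {q : ℕ} (K : FiniteField q) (3≤q : 3 ≤ q) where
  open FieldOps K
  open FiniteField K using (0≢1; invertible)

  private
    -- `N` is the order of the multiplicative group and `M` the exponent of inversion. The bound on
    -- `q` gives `N ≠ 1` and `M ≥ 1`, so that `x ^ M` respects the convention 0⁻¹ = 0.
    N M : ℕ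
    N = q ∸ 1
    M = q ∸ 2
    q≡1+N : suc N ≡ q
    q≡1+N = ℕ.m+[n∸m]≡n {1} (ℕ.≤-trans (s≤s z≤n) 3≤q)
    q≡2+M : suc (suc M) ≡ q
    q≡2+M = ℕ.m+[n∸m]≡n {2} (ℕ.≤-trans (s≤s (s≤s z≤n)) 3≤q)
    N≢1 : N ≢ 1
    N≢1 e = ℕ.<-irrefl (cong suc (sym e)) (subst (3 ≤_) (sym q≡1+N) 3≤q)

  ^≢0 : ∀ {x} → x ≢ 0# → ∀ r → x ^ r ≢ 0#
  ^≢0 x≢0 zero    e = 0≢1 (sym e)
  ^≢0 x≢0 (suc r) e = *-≢0 x≢0 (^≢0 x≢0 r) e

  ^-comm : ∀ x a b → (x ^ a) ^ b ≡ (x ^ b) ^ a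
  ^-comm x a b = trans (^-assocʳ x a b) (trans (cong (x ^_) (ℕ.*-comm a b)) (sym (^-assocʳ x b a)))

  -- Each step trades `x ^ q` for `x`. The exponent is kept positive so that 0 is covered as well.
  fermat-iterate : ∀ k x → x ^ suc (k ℕ.* N) ≡ x
  fermat-iterate zero    x = *-identityʳ x
  fermat-iterate (suc k) x = begin
    x ^ (suc N ℕ.+ k ℕ.* N)        ≡⟨ ^-homo-* x (suc N) (k ℕ.* N) ⟩
    x ^ suc N * x ^ (k ℕ.* N)      ≡⟨ cong (λ r → x ^ r * x ^ (k ℕ.* N)) q≡1+N ⟩
    x ^ q * x ^ (k ℕ.* N)          ≡⟨ cong (_* x ^ (k ℕ.* N)) (fermat x) ⟩
    x ^ suc (k ℕ.* N)              ≡⟨ fermat-iterate k x ⟩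
    x                              ∎

  ⁻¹-inverseʳ : ∀ {x} → x ≢ 0# → x * x ⁻¹ ≡ 1#
  ⁻¹-inverseʳ {x} x≢0 with x ≟ 0#
  ... | yes e = ⊥-elim (x≢0 e)
  ... | no  n = proj₂ (invertible x n)

  *-^M : ∀ {x} → x ≢ 0# → x * x ^ M ≡ 1#
  *-^M {x} x≢0 = *-cancelˡ x≢0 (begin
    x ^ suc (suc M) ≡⟨ cong (x ^_) q≡2+M ⟩
    x ^ q           ≡⟨ fermat x ⟩
    x               ≡⟨ *-identityʳ x ⟨
    x * 1#          ∎)

  0^M : 0# ^ M ≡ 0#
  0^M = trans (cong (0# ^_) (sym (ℕ.m+[n∸m]≡n {1} (ℕ.∸-monoˡ-≤ 2 3≤q)))) (0^suc (M ∸ 1))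

  -- With inversion as a power map, every integer exponent becomes a natural one and the exponent
  -- laws over ℕ suffice.
  ⁻¹≡^ : ∀ x → x ⁻¹ ≡ x ^ M
  ⁻¹≡^ x with x ≟ 0#
  ... | yes refl = sym 0^M
  ... | no x≢0   = *-cancelˡ x≢0 (trans (proj₂ (invertible x x≢0)) (sym (*-^M x≢0)))

  ^M-involutive : ∀ x → (x ^ M) ^ M ≡ x
  ^M-involutive x with x ≟ 0#
  ... | yes refl = trans (cong (_^ M) 0^M) 0^M
  ... | no x≢0   = *-cancelˡ (^≢0 x≢0 M) (trans (*-^M (^≢0 x≢0 M)) (sym (trans (*-comm _ _) (*-^M x≢0))))

  ^ᶻ⇒^ : ∀ i → ∃[ a ] ∀ x → x ^ᶻ i ≡ x ^ a
  ^ᶻ⇒^ (+ a)    = a , λ _ → refl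
  ^ᶻ⇒^ -[1+ a ] = M ℕ.* suc a , λ x → trans (cong (_^ suc a) (⁻¹≡^ x)) (^-assocʳ x M (suc a))

  ^-root : ∀ t → Coprime t N → ∃[ s ] ∀ x → (x ^ s) ^ t ≡ x
  ^-root t c with inverse-mod t N N≢1 c
  ... | s , k , e = s , λ x → trans (^-assocʳ x s t) (trans (cong (x ^_) e) (fermat-iterate k x))

  -- The power map permutes the whole field, 0 included, and its inverse is again a power; both
  -- composites are recorded for reindexing sums. For negative `t` the root for the absolute value
  -- is composed with inversion, whence `M * s`.
  ^ᶻ-root : ∀ t → ℤ.gcd t (+ N) ≡ 1ℤ → ∃[ s ] (∀ x → (x ^ s) ^ᶻ t ≡ x) × (∀ x → (x ^ᶻ t) ^ s ≡ x)
  ^ᶻ-root (+ t) c with ^-root t (gcd≡1⇒coprime (ℤ.+-injective c))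
  ... | s , e = s , e , λ x → trans (^-comm x t s) (e x)
  ^ᶻ-root -[1+ t ] c with ^-root (suc t) (gcd≡1⇒coprime (ℤ.+-injective c))
  ... | s , e = M ℕ.* s , left , right
    where
    left : ∀ x → ((x ^ (M ℕ.* s)) ⁻¹) ^ suc t ≡ x
    left x = begin
      ((x ^ (M ℕ.* s)) ⁻¹) ^ suc t      ≡⟨ cong (_^ suc t) (⁻¹≡^ _) ⟩
      ((x ^ (M ℕ.* s)) ^ M) ^ suc t     ≡⟨ cong (λ z → (z ^ M) ^ suc t) (^-assocʳ x M s) ⟨
      (((x ^ M) ^ s) ^ M) ^ suc t       ≡⟨ cong (_^ suc t) (^-comm (x ^ M) s M) ⟩
      (((x ^ M) ^ M) ^ s) ^ suc t       ≡⟨ e _ ⟩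
      (x ^ M) ^ M                       ≡⟨ ^M-involutive x ⟩
      x                                 ∎
    right : ∀ x → ((x ⁻¹) ^ suc t) ^ (M ℕ.* s) ≡ x
    right x = begin
      ((x ⁻¹) ^ suc t) ^ (M ℕ.* s)      ≡⟨ cong (λ z → (z ^ suc t) ^ (M ℕ.* s)) (⁻¹≡^ x) ⟩
      ((x ^ M) ^ suc t) ^ (M ℕ.* s)     ≡⟨ ^-assocʳ _ M s ⟨
      (((x ^ M) ^ suc t) ^ M) ^ s       ≡⟨ cong (_^ s) (^-comm _ (suc t) M) ⟩
      (((x ^ M) ^ M) ^ suc t) ^ s       ≡⟨ cong (λ z → (z ^ suc t) ^ s) (^M-involutive x) ⟩
      (x ^ suc t) ^ s                   ≡⟨ ^-comm x (suc t) s ⟩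
      (x ^ s) ^ suc t                   ≡⟨ e x ⟩
      x                                 ∎

  ∏-const : ∀ r a → Multiplicative.sum {r} (λ _ → a) ≡ a ^ r
  ∏-const zero    a = refl
  ∏-const (suc r) a = cong (a *_) (∏-const r a)

  ∏-≢0 : ∀ {r} (f : Fin r → Carrier) → (∀ i → f i ≢ 0#) → Multiplicative.sum f ≢ 0#
  ∏-≢0 {zero}  f e = 0≢1 ∘ sym
  ∏-≢0 {suc r} f e = *-≢0 (e zero) (∏-≢0 (f ∘ suc) (e ∘ suc))

  -- Multiplication by u permutes U, so the product of U is unchanged by the factor u^d.
  lagrange : ∀ {d U} → IsCyclicSubgroupOfOrder d U → ∀ u → U u → u ^ d ≡ 1#
  lagrange {d} {U} cyc u Uu = *-cancelˡ (∏-≢0 element (λ j → U-≢0 _ (Equivalence.from (exhaustive _) (j , refl)))) (begin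
    P * u ^ d                                      ≡⟨ cong (P *_) (∏-const d u) ⟨
    P * Multiplicative.sum {d} (λ _ → u)           ≡⟨ *-comm _ _ ⟩
    Multiplicative.sum {d} (λ _ → u) * P           ≡⟨ Multiplicative.∑-distrib-+ (λ _ → u) element ⟨
    Multiplicative.sum (λ j → u * element j)       ≡⟨ Multiplicative.sum-cong-≗ {d} (λ j → position-element Uu j) ⟨
    Multiplicative.sum (λ j → element (position Uu j)) ≡⟨ Multiplicative.sum-permute element π ⟨
    P                                              ≡⟨ *-identityʳ P ⟨
    P * 1#                                         ∎)
    where
    open IsCyclicSubgroupOfOrder cyc
    P = Multiplicative.sum element
    U⇒^ : ∀ w → U w → ∃[ a ] w ≡ generator ^ a
    U⇒^ w Uw with Equivalence.to (generates w) Uw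
    ... | i , e with ^ᶻ⇒^ i
    ... | a , e′ = a , trans e (e′ generator)
    ^⇒U : ∀ {w} a → w ≡ generator ^ a → U w
    ^⇒U a e = Equivalence.from (generates _) (+ a , e)
    U-≢0 : ∀ w → U w → w ≢ 0#
    U-≢0 w Uw w≡0 with U⇒^ w Uw
    ... | a , e = ^≢0 generator≢0 a (trans (sym e) w≡0)
    U-* : ∀ {w z} → U w → U z → U (w * z)
    U-* Uw Uz with U⇒^ _ Uw | U⇒^ _ Uz
    ... | a , e | b , e′ = ^⇒U (a ℕ.+ b) (trans (cong₂ _*_ e e′) (sym (^-homo-* generator a b)))
    U-^ : ∀ {w} r → U w → U (w ^ r)
    U-^ r Uw with U⇒^ _ Uw
    ... | a , e = ^⇒U (a ℕ.* r) (trans (cong (_^ r) e) (^-assocʳ generator a r))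
    place : ∀ {w} → U w → (j : Fin d) → ∃[ i ] w * element j ≡ element i
    place Uw j = Equivalence.to (exhaustive _) (U-* Uw (Equivalence.from (exhaustive _) (j , refl)))
    position : ∀ {w} → U w → Fin d → Fin d
    position Uw j = proj₁ (place Uw j)
    position-element : ∀ {w} (Uw : U w) j → element (position Uw j) ≡ w * element j
    position-element Uw j = sym (proj₂ (place Uw j))
    cancel : ∀ {w z} (Uw : U w) (Uz : U z) → w * z ≡ 1# → ∀ j → position Uw (position Uz j) ≡ j
    cancel {w} {z} Uw Uz e j = distinct (begin
      element (position Uw (position Uz j))  ≡⟨ position-element Uw _ ⟩
      w * element (position Uz j)            ≡⟨ cong (w *_) (position-element Uz j) ⟩
      w * (z * element j)                    ≡⟨ *-assoc w z _ ⟨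
      w * z * element j                      ≡⟨ cong (_* element j) e ⟩
      1# * element j                         ≡⟨ *-identityˡ _ ⟩
      element j                              ∎)
    -- The inverse permutation multiplies by `u ^ M`, the inverse of `u`, which lies in U as a power
    -- of `u`.
    π : Permutation d d
    π = mk↔ₛ′ (position Uu) (position (U-^ M Uu))
          (cancel Uu (U-^ M Uu) (*-^M (U-≢0 u Uu)))
          (cancel (U-^ M Uu) Uu (trans (*-comm _ _) (*-^M (U-≢0 u Uu))))

-- Conjugation x ↦ x^Q and the trace of 𝔽_{Q²} over 𝔽_Q, where Q = 2^m

3≤q : ∀ m → 2 ≤ m → 3 ≤ 2 ℕ.^ (2 ℕ.* m)
3≤q m 2≤m = ℕ.≤-trans (ℕ.n≤1+n 3) (ℕ.^-monoʳ-≤ 2 (ℕ.≤-trans 2≤m (ℕ.m≤m+n m _)))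

module Quadratic (m : ℕ) (2≤m : 2 ≤ m) (K : FiniteField (2 ℕ.^ (2 ℕ.* m))) where
  open QuadraticExtension m K
  open FiniteField K using (0≢1; commutativeRing)
  open FieldSums K
  open SemiringSolver (CommutativeRing.commutativeSemiring commutativeRing)
    using (solve; _:=_; _:+_; _:*_; con)

  private
    Q : ℕ
    Q = 2 ℕ.^ m
    4≤Q : 4 ≤ Q
    4≤Q = ℕ.^-monoʳ-≤ 2 2≤m

  open Powers K (3≤q m 2≤m)

  x+y≡0⇒x≡y : ∀ {x y} → x + y ≡ 0# → x ≡ y
  x+y≡0⇒x≡y {x} {y} e = begin
    x             ≡⟨ +-identityʳ x ⟨
    x + 0#        ≡⟨ cong (λ z → x + z) (x+x≡0 y) ⟨
    x + (y + y)   ≡⟨ +-assoc x y y ⟨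
    x + y + y     ≡⟨ cong (_+ y) e ⟩
    0# + y        ≡⟨ +-identityˡ y ⟩
    y             ∎

  x+y+y≡x : ∀ x y → x + y + y ≡ x
  x+y+y≡x x y = trans (+-assoc x y y) (trans (cong (λ z → x + z) (x+x≡0 y)) (+-identityʳ x))

  scale : ∀ {a b} → a * b ≡ 1# → ∀ x → a * (b * x) ≡ x
  scale {a} {b} e x = trans (sym (*-assoc a b x)) (trans (cong (_* x) e) (*-identityˡ x))

  -- In characteristic 2 the equation says `(x + 1)² = 0`.
  square≡1 : ∀ {x} → x * x ≡ 1# → x ≡ 1#
  square≡1 {x} e with x + 1# ≟ 0#
  ... | yes p = x+y≡0⇒x≡y p
  ... | no ≢0 = ⊥-elim (*-≢0 ≢0 ≢0 (begin
    (x + 1#) * (x + 1#)       ≡⟨ ^2 (x + 1#) ⟨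
    (x + 1#) ^ 2              ≡⟨ square-+ x 1# ⟩
    x ^ 2 + 1# ^ 2            ≡⟨ cong₂ _+_ (trans (^2 x) e) (1^ 2) ⟩
    1# + 1#                   ≡⟨ 1+1≡0 ⟩
    0#                        ∎))

  conj : Carrier → Carrier
  conj x = x ^ Q

  Fixed : Carrier → Set
  Fixed x = conj x ≡ x

  conj-conj : ∀ x → conj (conj x) ≡ x
  conj-conj x = begin
    (x ^ Q) ^ Q           ≡⟨ ^-assocʳ x Q Q ⟩
    x ^ (Q ℕ.* Q)         ≡⟨ cong (x ^_) (ℕ.^-distribˡ-+-* 2 m m) ⟨
    x ^ (2 ℕ.^ (m ℕ.+ m)) ≡⟨ cong (λ z → x ^ (2 ℕ.^ (m ℕ.+ z))) (ℕ.+-identityʳ m) ⟨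
    x ^ (2 ℕ.^ (2 ℕ.* m)) ≡⟨ fermat x ⟩
    x                     ∎

  fixed-+ : ∀ {x y} → Fixed x → Fixed y → Fixed (x + y)
  fixed-+ {x} {y} p p′ = trans (frobenius-+ m x y) (cong₂ _+_ p p′)

  fixed-* : ∀ {x y} → Fixed x → Fixed y → Fixed (x * y)
  fixed-* {x} {y} p p′ = trans (^-distrib-* x y Q) (cong₂ _*_ p p′)

  fixed-^ : ∀ {x} r → Fixed x → Fixed (x ^ r)
  fixed-^ {x} r p = trans (^-comm x r Q) (cong (_^ r) p)

  fixed-⁻¹ : ∀ {x} → Fixed x → Fixed (x ⁻¹)
  fixed-⁻¹ {x} p = subst Fixed (sym (⁻¹≡^ x)) (fixed-^ (2 ℕ.^ (2 ℕ.* m) ∸ 2) p)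

  *-⁻¹-cancel : ∀ {x} → x ≢ 0# → ∀ y → y * x ⁻¹ * x ≡ y
  *-⁻¹-cancel {x} x≢0 y = begin
    y * x ⁻¹ * x     ≡⟨ *-assoc y _ x ⟩
    y * (x ⁻¹ * x)   ≡⟨ cong (y *_) (trans (*-comm _ x) (⁻¹-inverseʳ x≢0)) ⟩
    y * 1#           ≡⟨ *-identityʳ y ⟩
    y                ∎

  tr : Carrier → Carrier
  tr x = x + conj x

  tr-fixed : ∀ x → Fixed (tr x)
  tr-fixed x = proj₂ (Trₘ x)

  tr-+ : ∀ x y → tr (x + y) ≡ tr x + tr y
  tr-+ x y = trans (cong (λ z → x + y + z) (frobenius-+ m x y))
    (solve 4 (λ a b c d → (a :+ b) :+ (c :+ d) := (a :+ c) :+ (b :+ d)) refl x y (conj x) (conj y))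

  tr-*ˡ : ∀ {a} → Fixed a → ∀ x → tr (a * x) ≡ a * tr x
  tr-*ˡ {a} p x = begin
    a * x + conj (a * x)      ≡⟨ cong (λ z → a * x + z) (^-distrib-* a x Q) ⟩
    a * x + conj a * conj x   ≡⟨ cong (λ z → a * x + z * conj x) p ⟩
    a * x + a * conj x        ≡⟨ distribˡ a x (conj x) ⟨
    a * tr x                  ∎

  tr≡0 : ∀ {x} → Fixed x → tr x ≡ 0#
  tr≡0 {x} p = trans (cong (λ z → x + z) p) (x+x≡0 x)

  -- Together with `tr≡0`, this identifies the kernel of `tr` with the subfield; elements outside it
  -- thus supply nonzero denominators `tr X`.
  tr≡0⇒fixed : ∀ {x} → tr x ≡ 0# → Fixed x
  tr≡0⇒fixed e = sym (x+y≡0⇒x≡y e)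

  -- On the subfield the norm `u ^ (Q + 1)` is `u * u`, so norm 1 would force `u = 1`.
  norm1⇒¬fixed : ∀ {u} → u ^ (Q ℕ.+ 1) ≡ 1# → u ≢ 1# → ¬ Fixed u
  norm1⇒¬fixed {u} e u≢1 p = u≢1 (square≡1 (begin
    u * u             ≡⟨ cong₂ _*_ p (*-identityʳ u) ⟨
    u ^ Q * u ^ 1     ≡⟨ ^-homo-* u Q 1 ⟨
    u ^ (Q ℕ.+ 1)     ≡⟨ e ⟩
    1#                ∎))

  ^[Q-1]-* : ∀ x → x ^ (Q ∸ 1) * x ≡ conj x
  ^[Q-1]-* x = trans (*-comm _ x) (cong (x ^_) (ℕ.m+[n∸m]≡n {1} (ℕ.≤-trans (s≤s z≤n) 4≤Q)))

  fixed⇒^[Q-1]≡1 : ∀ {x} → Fixed x → x ≢ 0# → x ^ (Q ∸ 1) ≡ 1#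
  fixed⇒^[Q-1]≡1 {x} p x≢0 = *-cancelˡ x≢0 (begin
    x * x ^ (Q ∸ 1)   ≡⟨ *-comm _ _ ⟩
    x ^ (Q ∸ 1) * x   ≡⟨ ^[Q-1]-* x ⟩
    conj x            ≡⟨ p ⟩
    x                 ≡⟨ *-identityʳ x ⟨
    x * 1#            ∎)

  -- Sums over the subfield

  ι : Carrier → ℤ
  ι x = [ conj x ≟ x ]

  ι-yes : ∀ {x} → Fixed x → ι x ≡ 1ℤ
  ι-yes {x} p = []-yes (conj x ≟ x) p

  ι-no : ∀ {x} → ¬ Fixed x → ι x ≡ 0ℤ
  ι-no {x} p = []-no (conj x ≟ x) p

  -- Extension by zero turns sums over the subfield into sums over the whole field. It also depends
  -- on the underlying element alone, so that equations in `Carrier` can be applied to functions on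
  -- `Subfield`.
  ext : (Subfield → ℤ) → Carrier → ℤ
  ext f x with conj x ≟ x
  ... | yes p = f (x , p)
  ... | no  _ = 0ℤ

  ext-yes : ∀ f {x} (p : Fixed x) → ext f x ≡ f (x , p)
  ext-yes f {x} p with conj x ≟ x
  ... | yes p′ = cong (λ r → f (x , r)) (≡-irrelevant p′ p)
  ... | no ¬p  = ⊥-elim (¬p p)

  ext-no : ∀ f {x} → ¬ Fixed x → ext f x ≡ 0ℤ
  ext-no f {x} ¬p with conj x ≟ x
  ... | yes p = ⊥-elim (¬p p)
  ... | no _  = refl

  -- The bijection lists the elements `e j` of the fibre without repetition, so the indicator of the
  -- fibre is the sum of the point indicators of the `e j`. Exchanging the two sums leaves N ones.
  Σ-ext-fibre : ∀ {k} (h : Subfield → 𝔽₂^ k) b {N} → Fin N ↔ (∃[ y ] h y ≡ b) →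
                Σ𝔽 (ext (λ y → [ h y ≟₂ b ])) ≡ + N
  Σ-ext-fibre h b {N} bij = begin
    Σ𝔽 (ext (λ y → [ h y ≟₂ b ]))                 ≡⟨ Σ-cong pointwise ⟩
    Σ𝔽 (λ x → ∑.sum (λ j → [ x ≟ e j ]))          ≡⟨ ∑.∑-comm (λ i j → [ elem i ≟ e j ]) ⟩
    ∑.sum (λ j → Σ𝔽 (λ x → [ x ≟ e j ]))          ≡⟨ ∑.sum-cong-≗ {N} column ⟩
    ∑.sum {N} (λ _ → 1ℤ)                          ≡⟨ sum-1 N ⟩
    + N                                           ∎
    where
    e : Fin N → Carrier
    e j = proj₁ (proj₁ (Inverse.to bij j))
    column : ∀ j → Σ𝔽 (λ x → [ x ≟ e j ]) ≡ 1ℤ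
    column j = trans (Σ-cong (λ x → sym (ℤ.*-identityʳ [ x ≟ e j ]))) (Σ-δ (e j) 1ℤ)
    -- Both proof components are unique, so a point of the fibre is determined by its field element;
    -- hence the `e j` are distinct.
    fibre-≡ : ∀ (s t : ∃[ y ] h y ≡ b) → proj₁ (proj₁ s) ≡ proj₁ (proj₁ t) → s ≡ t
    fibre-≡ ((x , p) , r) ((.x , p′) , r′) refl with ≡-irrelevant p p′
    ... | refl = cong (_ ,_) (≡-irrelevant r r′)
    none : ∀ x → (∀ j → x ≢ e j) → ∑.sum (λ j → [ x ≟ e j ]) ≡ 0ℤ
    none x x≢ = trans (∑.sum-cong-≗ {N} (λ j → []-no (x ≟ e j) (x≢ j))) (∑.sum-replicate-zero N)
    pointwise : ∀ x → ext (λ y → [ h y ≟₂ b ]) x ≡ ∑.sum (λ j → [ x ≟ e j ])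
    pointwise x with conj x ≟ x
    ... | no ¬p = sym (none x λ { j refl → ¬p (proj₂ (proj₁ (Inverse.to bij j))) })
    ... | yes p with h (x , p) ≟₂ b
    ...   | no ¬r = sym (none x λ { j refl → ¬r (trans (cong (λ r → h (x , r)) (≡-irrelevant p _)) (proj₂ (Inverse.to bij j))) })
    ...   | yes r = sym (trans
      (sum-single (λ j → [ x ≟ e j ]) j₀ (λ j j≢ → []-no (x ≟ e j) (λ x≡ → j≢ (begin
        j                                     ≡⟨ Inverse.strictlyInverseʳ bij j ⟨
        Inverse.from bij (Inverse.to bij j)   ≡⟨ cong (Inverse.from bij) (fibre-≡ (Inverse.to bij j) ((x , p) , r) (sym x≡)) ⟩
        j₀                                    ∎))))
      ([]-yes (x ≟ e j₀) (sym (cong (λ s → proj₁ (proj₁ s)) (Inverse.strictlyInverseˡ bij ((x , p) , r))))))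
      where j₀ = Inverse.from bij ((x , p) , r)

  -- Sorted by the value `b`, the sum receives N copies of `φ b` from each fibre. The factor `2 ^ k`
  -- replaces a division, since N is known through `N * 2 ^ k = Q`.
  Σ-ext-balanced : ∀ {k} (h : Subfield → 𝔽₂^ k) → Balanced h → ∀ φ →
                   + (2 ℕ.^ k) ℤ.* Σ𝔽 (ext (λ y → φ (h y))) ≡ + Q ℤ.* ∑₂ φ
  Σ-ext-balanced {k} h bal φ = begin
    + (2 ℕ.^ k) ℤ.* Σ𝔽 (ext (λ y → φ (h y)))
      ≡⟨ cong (+ (2 ℕ.^ k) ℤ.*_) (Σ-cong pointwise) ⟩
    + (2 ℕ.^ k) ℤ.* Σ𝔽 (λ x → ∑₂ (λ b → φ b ℤ.* c b x))
      ≡⟨ cong (+ (2 ℕ.^ k) ℤ.*_) (Σ-∑₂ (λ x b → φ b ℤ.* c b x)) ⟩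
    + (2 ℕ.^ k) ℤ.* ∑₂ (λ b → Σ𝔽 (λ x → φ b ℤ.* c b x))
      ≡⟨ ∑₂-*ˡ (+ (2 ℕ.^ k)) (λ b → Σ𝔽 (λ x → φ b ℤ.* c b x)) ⟩
    ∑₂ (λ b → + (2 ℕ.^ k) ℤ.* Σ𝔽 (λ x → φ b ℤ.* c b x))
      ≡⟨ ∑₂-cong fibre ⟩
    ∑₂ (λ b → + Q ℤ.* φ b)
      ≡⟨ ∑₂-*ˡ (+ Q) φ ⟨
    + Q ℤ.* ∑₂ φ ∎
    where
    c : 𝔽₂^ k → Carrier → ℤ
    c b = ext (λ y → [ h y ≟₂ b ])
    pointwise : ∀ x → ext (λ y → φ (h y)) x ≡ ∑₂ (λ b → φ b ℤ.* c b x)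
    pointwise x with conj x ≟ x
    ... | yes p = sym (∑₂-select φ (h (x , p)))
    ... | no _  = sym (trans (∑₂-cong (λ b → ℤ.*-zeroʳ (φ b))) (∑₂-0 k))
    rearrange : ∀ p a n → p ℤ.* (a ℤ.* n) ≡ (n ℤ.* p) ℤ.* a
    rearrange = ℤ-solve-∀
    fibre : ∀ b → + (2 ℕ.^ k) ℤ.* Σ𝔽 (λ x → φ b ℤ.* c b x) ≡ + Q ℤ.* φ b
    fibre b with bal b
    ... | N , N*2^k≡Q , bij = begin
      + (2 ℕ.^ k) ℤ.* Σ𝔽 (λ x → φ b ℤ.* c b x)    ≡⟨ cong (+ (2 ℕ.^ k) ℤ.*_) (Σ-*ˡ (φ b) (c b)) ⟨
      + (2 ℕ.^ k) ℤ.* (φ b ℤ.* Σ𝔽 (c b))          ≡⟨ cong (λ z → + (2 ℕ.^ k) ℤ.* (φ b ℤ.* z)) (Σ-ext-fibre h b bij) ⟩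
      + (2 ℕ.^ k) ℤ.* (φ b ℤ.* + N)               ≡⟨ rearrange (+ (2 ℕ.^ k)) (φ b) (+ N) ⟩
      (+ N ℤ.* + (2 ℕ.^ k)) ℤ.* φ b               ≡⟨ cong (ℤ._* φ b) (ℤ.pos-* N (2 ℕ.^ k)) ⟨
      + (N ℕ.* 2 ℕ.^ k) ℤ.* φ b                   ≡⟨ cong (λ z → + z ℤ.* φ b) N*2^k≡Q ⟩
      + Q ℤ.* φ b                                 ∎

  private
    +2^-nonZero : ∀ k → ℤ.NonZero (+ (2 ℕ.^ k))
    +2^-nonZero k = ℕ.m^n≢0 2 k

  -- The balanced function itself counts the subfield: its fibres partition it, and their sizes add
  -- up to Q. No roots of `y ^ Q = y` have to be found.
  Σι≡Q : ∀ {k} (h : Subfield → 𝔽₂^ k) → Balanced h → Σ𝔽 ι ≡ + Q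
  Σι≡Q {k} h bal = ℤ.*-cancelˡ-≡ (+ (2 ℕ.^ k)) _ _ {{+2^-nonZero k}} (begin
    + (2 ℕ.^ k) ℤ.* Σ𝔽 ι                 ≡⟨ cong (+ (2 ℕ.^ k) ℤ.*_) (Σ-cong ι≡ext) ⟩
    + (2 ℕ.^ k) ℤ.* Σ𝔽 (ext (λ _ → 1ℤ))  ≡⟨ Σ-ext-balanced h bal (λ _ → 1ℤ) ⟩
    + Q ℤ.* ∑₂ {k} (λ _ → 1ℤ)            ≡⟨ cong (+ Q ℤ.*_) (∑₂-1 k) ⟩
    + Q ℤ.* + (2 ℕ.^ k)                  ≡⟨ ℤ.*-comm (+ Q) (+ (2 ℕ.^ k)) ⟩
    + (2 ℕ.^ k) ℤ.* + Q                  ∎)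
    where
    ι≡ext : ∀ x → ι x ≡ ext (λ _ → 1ℤ) x
    ι≡ext x with conj x ≟ x
    ... | yes _ = refl
    ... | no _  = refl

  -- A balanced map sends the uniform distribution on the subfield to the uniform one on 𝔽₂^k, where
  -- a nontrivial character has sum zero.
  Σ-component≡0 : ∀ {k} (h : Subfield → 𝔽₂^ k) → Balanced h → ∀ v → v ≢ 𝟎 →
                  Σ𝔽 (ext (λ y → -1^ ⟨ v , h y ⟩)) ≡ 0ℤ
  Σ-component≡0 {k} h bal v v≢0 = ℤ.*-cancelˡ-≡ (+ (2 ℕ.^ k)) _ _ {{+2^-nonZero k}} (begin
    + (2 ℕ.^ k) ℤ.* Σ𝔽 (ext (λ y → -1^ ⟨ v , h y ⟩))  ≡⟨ Σ-ext-balanced h bal (λ b → -1^ ⟨ v , b ⟩) ⟩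
    + Q ℤ.* ∑₂ (λ b → -1^ ⟨ v , b ⟩)                  ≡⟨ cong (+ Q ℤ.*_) (∑₂-character v v≢0) ⟩
    + Q ℤ.* 0ℤ                                        ≡⟨ ℤ.*-zeroʳ (+ Q) ⟩
    0ℤ                                                ≡⟨ ℤ.*-zeroʳ (+ (2 ℕ.^ k)) ⟨
    + (2 ℕ.^ k) ℤ.* 0ℤ                                ∎)

  -- The canonical additive character

  χ : Carrier → ℤ
  χ x = -1^ (Tr₁ x)

  private
    fromBool-injective : ∀ a b → fromBool a ≡ fromBool b → a ≡ b
    fromBool-injective false false _ = refl
    fromBool-injective false true  e = ⊥-elim (0≢1 e)
    fromBool-injective true  false e = ⊥-elim (0≢1 (sym e))
    fromBool-injective true  true  _ = refl

    fromBool-xor : ∀ a b → fromBool (a xor b) ≡ fromBool a + fromBool b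
    fromBool-xor false b     = sym (+-identityˡ _)
    fromBool-xor true  false = sym (+-identityʳ _)
    fromBool-xor true  true  = sym 1+1≡0

    fromBool-square : ∀ a → fromBool a ^ 2 ≡ fromBool a
    fromBool-square false = 0^suc 1
    fromBool-square true  = 1^ 2

    square-sum : ∀ {r} (f : Fin r → Carrier) → Additive.sum f ^ 2 ≡ Additive.sum (λ i → f i ^ 2)
    square-sum {zero}  f = 0^suc 1
    square-sum {suc r} f = trans (square-+ _ _) (cong (λ z → f zero ^ 2 + z) (square-sum (f ∘ suc)))

  Tr₁-+ : ∀ x y → Tr₁ (x + y) ≡ Tr₁ x xor Tr₁ y
  Tr₁-+ x y = fromBool-injective _ _ (begin
    fromBool (Tr₁ (x + y))                ≡⟨ Tr₁-correct (x + y) ⟩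
    traceSum (x + y)                      ≡⟨ Additive.sum-cong-≗ {n} (λ i → frobenius-+ (toℕ i) x y) ⟩
    Additive.sum {n} (λ i → x ^ (2 ℕ.^ toℕ i) + y ^ (2 ℕ.^ toℕ i))
                                          ≡⟨ Additive.∑-distrib-+ {n} (λ i → x ^ (2 ℕ.^ toℕ i)) (λ i → y ^ (2 ℕ.^ toℕ i)) ⟩
    traceSum x + traceSum y               ≡⟨ cong₂ _+_ (Tr₁-correct x) (Tr₁-correct y) ⟨
    fromBool (Tr₁ x) + fromBool (Tr₁ y)   ≡⟨ fromBool-xor (Tr₁ x) (Tr₁ y) ⟨
    fromBool (Tr₁ x xor Tr₁ y)            ∎)
    where n = 2 ℕ.* m

  Tr₁-square : ∀ x → Tr₁ (x ^ 2) ≡ Tr₁ x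
  Tr₁-square x = fromBool-injective _ _ (begin
    fromBool (Tr₁ (x ^ 2))                             ≡⟨ Tr₁-correct (x ^ 2) ⟩
    traceSum (x ^ 2)                                   ≡⟨ Additive.sum-cong-≗ {n} (λ i → ^-comm x 2 (2 ℕ.^ toℕ i)) ⟩
    Additive.sum {n} (λ i → (x ^ (2 ℕ.^ toℕ i)) ^ 2)   ≡⟨ square-sum {n} (λ i → x ^ (2 ℕ.^ toℕ i)) ⟨
    traceSum x ^ 2                                     ≡⟨ cong (_^ 2) (Tr₁-correct x) ⟨
    fromBool (Tr₁ x) ^ 2                               ≡⟨ fromBool-square (Tr₁ x) ⟩
    fromBool (Tr₁ x)                                   ∎)
    where n = 2 ℕ.* m

  Tr₁-frobenius : ∀ r x → Tr₁ (x ^ (2 ℕ.^ r)) ≡ Tr₁ x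
  Tr₁-frobenius zero    x = cong Tr₁ (*-identityʳ x)
  Tr₁-frobenius (suc r) x = begin
    Tr₁ (x ^ (2 ℕ.* 2 ℕ.^ r))   ≡⟨ cong Tr₁ (^-assocʳ x 2 (2 ℕ.^ r)) ⟨
    Tr₁ ((x ^ 2) ^ (2 ℕ.^ r))   ≡⟨ Tr₁-frobenius r (x ^ 2) ⟩
    Tr₁ (x ^ 2)                 ≡⟨ Tr₁-square x ⟩
    Tr₁ x                       ∎

  -- Conjugation is an iterate of Frobenius and preserves `Tr₁`, so the two contributions cancel.
  Tr₁-tr : ∀ x → Tr₁ (tr x) ≡ false
  Tr₁-tr x = begin
    Tr₁ (x + conj x)        ≡⟨ Tr₁-+ x (conj x) ⟩
    Tr₁ x xor Tr₁ (conj x)  ≡⟨ cong (Tr₁ x xor_) (Tr₁-frobenius m x) ⟩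
    Tr₁ x xor Tr₁ x         ≡⟨ Bool.xor-same (Tr₁ x) ⟩
    false                   ∎

  χ-+ : ∀ x y → χ (x + y) ≡ χ x ℤ.* χ y
  χ-+ x y = trans (cong -1^ (Tr₁-+ x y)) (-1^-xor (Tr₁ x) (Tr₁ y))

  -- Sums of x ↦ ψ (T u x)

  private
    module +∑ = SemiringSum (CommutativeRing.semiring commutativeRing)
    H : ℕ
    H = 2 ℕ.^ (m ∸ 1)
    2*H≡Q : 2 ℕ.* H ≡ Q
    2*H≡Q = cong (2 ℕ.^_) (ℕ.m+[n∸m]≡n {1} (ℕ.≤-trans (s≤s z≤n) 2≤m))

    H-even : 2 ℕ.^ (m ∸ 2) ℕ.* 2 ≡ H
    H-even = trans (ℕ.*-comm (2 ℕ.^ (m ∸ 2)) 2) (cong (2 ℕ.^_) (lem 2≤m))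
      where
      lem : ∀ {r} → 2 ≤ r → suc (r ∸ 2) ≡ r ∸ 1
      lem (s≤s (s≤s z≤n)) = refl

    ∑1-even : ∀ r → Additive.sum {r ℕ.* 2} (λ _ → 1#) ≡ 0#
    ∑1-even zero    = refl
    ∑1-even (suc r) = begin
      1# + (1# + Additive.sum {r ℕ.* 2} (λ _ → 1#))  ≡⟨ cong (λ z → 1# + (1# + z)) (∑1-even r) ⟩
      1# + (1# + 0#)                                 ≡⟨ cong (λ z → 1# + z) (+-identityʳ 1#) ⟩
      1# + 1#                                        ≡⟨ 1+1≡0 ⟩
      0#                                             ∎

  geometric : ℕ → Carrier → Carrier
  geometric r w = Additive.sum {r} (λ i → w ^ suc (toℕ i))

  -- In characteristic 2 the factor `1 + w` is `1 - w`, so the product telescopes. The sum unfolds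
  -- at its first term, and the induction takes a factor `w` out of the rest.
  geometric-closed : ∀ r w → (1# + w) * geometric r w ≡ w + w ^ suc r
  geometric-closed zero    w = trans (zeroʳ _) (sym (trans (cong (λ z → w + z) (*-identityʳ w)) (x+x≡0 w)))
  geometric-closed (suc r) w = begin
    (1# + w) * (w * 1# + Additive.sum {r} (λ i → w * w ^ suc (toℕ i)))
      ≡⟨ cong₂ (λ y z → (1# + w) * (y + z)) (*-identityʳ w) (sym (+∑.*-distribˡ-sum {r} w (λ i → w ^ suc (toℕ i)))) ⟩
    (1# + w) * (w + w * g)            ≡⟨ solve 2 (λ w g → (con 1 :+ w) :* (w :+ w :* g) := w :+ w :* w :+ w :* ((con 1 :+ w) :* g)) refl w g ⟩
    w + w * w + w * ((1# + w) * g)    ≡⟨ cong (λ z → w + w * w + w * z) (geometric-closed r w) ⟩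
    w + w * w + w * (w + w ^ suc r)   ≡⟨ solve 2 (λ w p → w :+ w :* w :+ w :* (w :+ p) := w :+ w :* p :+ w :* w :+ w :* w) refl w (w ^ suc r) ⟩
    w + w ^ suc (suc r) + w * w + w * w ≡⟨ x+y+y≡x _ (w * w) ⟩
    w + w ^ suc (suc r)               ∎
    where g = geometric r w

  T≡ : ∀ u x → proj₁ (T u x) ≡ tr (u * geometric H (x ^ (Q ∸ 1)))
  T≡ u x = cong (λ s → tr (u * s)) (Additive.sum-cong-≗ {H} (λ i →
    trans (cong (x ^_) (ℕ.*-comm (suc (toℕ i)) (Q ∸ 1))) (sym (^-assocʳ x (Q ∸ 1) (suc (toℕ i))))))

  -- `T` sees `x` only through `x ^ (Q - 1)`, and this power is 1 on nonzero elements of the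
  -- subfield.
  T-homogeneous : ∀ u {a} → Fixed a → a ≢ 0# → ∀ x → proj₁ (T u (a * x)) ≡ proj₁ (T u x)
  T-homogeneous u {a} p a≢0 x = begin
    proj₁ (T u (a * x))                        ≡⟨ T≡ u (a * x) ⟩
    tr (u * geometric H ((a * x) ^ (Q ∸ 1)))   ≡⟨ cong (λ w → tr (u * geometric H w)) (begin
      (a * x) ^ (Q ∸ 1)                          ≡⟨ ^-distrib-* a x (Q ∸ 1) ⟩
      a ^ (Q ∸ 1) * x ^ (Q ∸ 1)                  ≡⟨ cong (_* x ^ (Q ∸ 1)) (fixed⇒^[Q-1]≡1 p a≢0) ⟩
      1# * x ^ (Q ∸ 1)                           ≡⟨ *-identityˡ _ ⟩
      x ^ (Q ∸ 1)                                ∎) ⟩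
    tr (u * geometric H (x ^ (Q ∸ 1)))         ≡⟨ T≡ u x ⟨
    proj₁ (T u x)                              ∎

  -- On nonzero x the sum in T has 2^(m-1) terms equal to 1, an even number as m ≥ 2.
  T-fixed : ∀ u {x} → Fixed x → proj₁ (T u x) ≡ 0#
  T-fixed u {x} p = begin
    proj₁ (T u x)                        ≡⟨ T≡ u x ⟩
    tr (u * geometric H (x ^ (Q ∸ 1)))   ≡⟨ cong (λ s → tr (u * s)) vanish ⟩
    tr (u * 0#)                          ≡⟨ cong tr (zeroʳ u) ⟩
    tr 0#                                ≡⟨ tr≡0 (0^2^ m) ⟩
    0#                                   ∎
    where
    geometric-0 : geometric H 0# ≡ 0#
    geometric-0 = trans (Additive.sum-cong-≗ {H} (λ i → 0^suc (toℕ i))) (Additive.sum-replicate-zero H)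
    geometric-1 : geometric H 1# ≡ 0#
    geometric-1 = begin
      geometric H 1#                                 ≡⟨ Additive.sum-cong-≗ {H} (λ i → 1^ (suc (toℕ i))) ⟩
      Additive.sum {H} (λ _ → 1#)                    ≡⟨ cong (λ r → Additive.sum {r} (λ _ → 1#)) H-even ⟨
      Additive.sum {2 ℕ.^ (m ∸ 2) ℕ.* 2} (λ _ → 1#)  ≡⟨ ∑1-even (2 ℕ.^ (m ∸ 2)) ⟩
      0#                                             ∎
    -- At 0 the ratio vanishes because `Q - 1 ≥ 1`, and so does every term, since the progression
    -- starts at exponent 1.
    0^[Q-1] : 0# ^ (Q ∸ 1) ≡ 0#
    0^[Q-1] = trans (cong (0# ^_) (sym (ℕ.m+[n∸m]≡n {1} (ℕ.∸-monoˡ-≤ 1 (ℕ.≤-trans (s≤s (s≤s z≤n)) 4≤Q))))) (0^suc (Q ∸ 1 ∸ 1))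
    vanish : geometric H (x ^ (Q ∸ 1)) ≡ 0#
    vanish with x ≟ 0#
    ... | yes refl = trans (cong (geometric H) 0^[Q-1]) geometric-0
    ... | no x≢0   = trans (cong (geometric H) (fixed⇒^[Q-1]≡1 p x≢0)) geometric-1

  -- With Y = conj X and z = Y^(Q-1) = X/Y the geometric sum runs over powers
  -- of z², and its closed form z²(1 + conj z)/(1 + z²) is X/(X + Y).
  T-formula : ∀ u X → tr X ≢ 0# → tr X * proj₁ (T u (conj X ^ 2)) ≡ tr (u * X)
  T-formula u X d≢0 = begin
    d * proj₁ (T u (Y ^ 2))                          ≡⟨ cong (d *_) (T≡ u (Y ^ 2)) ⟩
    d * tr (u * geometric H ((Y ^ 2) ^ (Q ∸ 1)))     ≡⟨ cong (λ w → d * tr (u * geometric H w)) (^-comm Y 2 (Q ∸ 1)) ⟩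
    d * tr (u * S)                                   ≡⟨ tr-*ˡ (tr-fixed X) (u * S) ⟨
    tr (d * (u * S))                                 ≡⟨ cong tr (solve 3 (λ d u S → d :* (u :* S) := u :* (d :* S)) refl d u S) ⟩
    tr (u * (d * S))                                 ≡⟨ cong (λ s → tr (u * s)) (*-cancelˡ d≢0 d*dS) ⟩
    tr (u * X)                                       ∎
    where
    d = tr X
    Y = conj X
    z = Y ^ (Q ∸ 1)
    S = geometric H (z ^ 2)
    zY≡X : z * Y ≡ X
    zY≡X = trans (^[Q-1]-* Y) (conj-conj X)
    X*conjz≡Y : X * conj z ≡ Y
    X*conjz≡Y = begin
      X * conj z        ≡⟨ cong (_* conj z) (conj-conj X) ⟨
      conj Y * conj z   ≡⟨ ^-distrib-* Y z Q ⟨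
      conj (Y * z)      ≡⟨ cong conj (trans (*-comm Y z) zY≡X) ⟩
      Y                 ∎
    z²^H : (z ^ 2) ^ H ≡ conj z
    z²^H = trans (^-assocʳ z 2 H) (cong (z ^_) 2*H≡Q)
    d*d : d * d ≡ Y * Y * (1# + z ^ 2)
    d*d = begin
      d * d                       ≡⟨ ^2 d ⟨
      d ^ 2                       ≡⟨ square-+ X Y ⟩
      X ^ 2 + Y ^ 2               ≡⟨ cong₂ _+_ (^2 X) (^2 Y) ⟩
      X * X + Y * Y               ≡⟨ cong (λ w → w * w + Y * Y) zY≡X ⟨
      z * Y * (z * Y) + Y * Y     ≡⟨ solve 2 (λ z Y → z :* Y :* (z :* Y) :+ Y :* Y := Y :* Y :* (con 1 :+ z :* z)) refl z Y ⟩
      Y * Y * (1# + z * z)        ≡⟨ cong (λ w → Y * Y * (1# + w)) (^2 z) ⟨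
      Y * Y * (1# + z ^ 2)        ∎
    -- The second factor `d` supplies the `1 + z²` that the closed form of `S` asks for: `d * d` is
    -- `Y²` times it.
    d*dS : d * (d * S) ≡ d * X
    d*dS = begin
      d * (d * S)                                ≡⟨ *-assoc d d S ⟨
      d * d * S                                  ≡⟨ cong (_* S) d*d ⟩
      Y * Y * (1# + z ^ 2) * S                   ≡⟨ *-assoc _ _ S ⟩
      Y * Y * ((1# + z ^ 2) * S)                 ≡⟨ cong (Y * Y *_) (geometric-closed H (z ^ 2)) ⟩
      Y * Y * (z ^ 2 + z ^ 2 * (z ^ 2) ^ H)      ≡⟨ cong₂ (λ a b → Y * Y * (a + a * b)) (^2 z) z²^H ⟩
      Y * Y * (z * z + z * z * conj z)           ≡⟨ solve 3 (λ Y z c → Y :* Y :* (z :* z :+ z :* z :* c) := z :* Y :* (z :* Y :+ z :* Y :* c)) refl Y z (conj z) ⟩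
      z * Y * (z * Y + z * Y * conj z)           ≡⟨ cong (λ w → w * (w + w * conj z)) zY≡X ⟩
      X * (X + X * conj z)                       ≡⟨ cong (λ w → X * (X + w)) X*conjz≡Y ⟩
      X * (X + Y)                                ≡⟨ *-comm X d ⟩
      d * X                                      ∎

  -- Translating the values of `T` by subfield elements

  module _ (u : Carrier) (u∉ : ¬ Fixed u) where

    private
      τ : Carrier
      τ = tr u
      τ≢0 : τ ≢ 0#
      τ≢0 e = u∉ (tr≡0⇒fixed e)

    -- As `τ ≠ 0`, every subfield element is a relative trace, `x = tr (x * τ ⁻¹ * u)`, and χ is
    -- trivial on those.
    χ-fixed : ∀ {x} → Fixed x → χ x ≡ 1ℤ
    χ-fixed {x} p = cong -1^ (begin
      Tr₁ x                    ≡⟨ cong Tr₁ (*-⁻¹-cancel τ≢0 x) ⟨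
      Tr₁ (x * τ ⁻¹ * τ)       ≡⟨ cong Tr₁ (tr-*ˡ (fixed-* p (fixed-⁻¹ (tr-fixed u))) u) ⟨
      Tr₁ (tr (x * τ ⁻¹ * u))  ≡⟨ Tr₁-tr (x * τ ⁻¹ * u) ⟩
      false                    ∎)

    shift : Carrier → Carrier → Carrier
    shift e X = X + e * τ ⁻¹ * tr X

    module _ {e : Carrier} (p : Fixed e) where
      private
        a : Carrier
        a = e * τ ⁻¹
        a-fixed : Fixed a
        a-fixed = fixed-* p (fixed-⁻¹ (tr-fixed u))

      tr-shift : ∀ X → tr (shift e X) ≡ tr X
      tr-shift X = begin
        tr (X + a * tr X)         ≡⟨ tr-+ X (a * tr X) ⟩
        tr X + tr (a * tr X)      ≡⟨ cong (λ z → tr X + z) (tr≡0 (fixed-* a-fixed (tr-fixed X))) ⟩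
        tr X + 0#                 ≡⟨ +-identityʳ _ ⟩
        tr X                      ∎

      shift-involutive : ∀ X → shift e (shift e X) ≡ X
      shift-involutive X = trans (cong (λ z → shift e X + a * z) (tr-shift X)) (x+y+y≡x X (a * tr X))

      ι-shift : ∀ X → ι (shift e X) ≡ ι X
      ι-shift X = []-cong
        (λ q → tr≡0⇒fixed (trans (sym (tr-shift X)) (tr≡0 q)))
        (λ q → tr≡0⇒fixed (trans (tr-shift X) (tr≡0 q))) _ _

      -- By `T-formula` the value is `tr (u * X)` over `tr X`. The shift keeps the denominator and
      -- adds `a * tr X * τ` to the numerator, which is `e` times the denominator because
      -- `a * τ = e`.
      T-shift : ∀ X → ¬ Fixed X → proj₁ (T u (conj (shift e X) ^ 2)) ≡ proj₁ (T u (conj X ^ 2)) + e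
      T-shift X X∉ = *-cancelˡ d≢0 (begin
        d * proj₁ (T u (conj X′ ^ 2))           ≡⟨ cong (_* proj₁ (T u (conj X′ ^ 2))) (tr-shift X) ⟨
        tr X′ * proj₁ (T u (conj X′ ^ 2))       ≡⟨ T-formula u X′ (λ q → d≢0 (trans (sym (tr-shift X)) q)) ⟩
        tr (u * X′)                             ≡⟨ cong tr (solve 4 (λ u X a d → u :* (X :+ a :* d) := u :* X :+ a :* d :* u) refl u X a d) ⟩
        tr (u * X + a * d * u)                  ≡⟨ tr-+ (u * X) (a * d * u) ⟩
        tr (u * X) + tr (a * d * u)             ≡⟨ cong (λ z → tr (u * X) + z) (tr-*ˡ (fixed-* a-fixed (tr-fixed X)) u) ⟩
        tr (u * X) + a * d * τ                  ≡⟨ cong₂ _+_ (T-formula u X d≢0) (solve 3 (λ a d t → d :* (a :* t) := a :* d :* t) refl a d τ) ⟨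
        d * t + d * (a * τ)                     ≡⟨ cong (λ z → d * t + d * z) (*-⁻¹-cancel τ≢0 e) ⟩
        d * t + d * e                           ≡⟨ distribˡ d t e ⟨
        d * (t + e)                             ∎)
        where
        X′ = shift e X
        d = tr X
        t = proj₁ (T u (conj X ^ 2))
        d≢0 : d ≢ 0#
        d≢0 q = X∉ (tr≡0⇒fixed q)

    module _ (Σι : Σ𝔽 ι ≡ + Q) where

      private
        Q-nonZero : ℤ.NonZero (+ Q)
        Q-nonZero = ℕ.m^n≢0 2 m

        Q-1-nonZero : ℤ.NonZero (+ Q ℤ.- 1ℤ)
        Q-1-nonZero = ℤ.≢-nonZero (λ e → ℕ.<-irrefl (sym (ℤ.+-injective (ℤ.i-j≡0⇒i≡j (+ Q) 1ℤ e)))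
                                     (ℕ.≤-trans (s≤s (s≤s z≤n)) 4≤Q))

        Σι* : ∀ c → Σ𝔽 (λ x → ι x ℤ.* c) ≡ + Q ℤ.* c
        Σι* c = trans (sym (Σ-*ʳ c ι)) (cong (ℤ._* c) Σι)

      Σ-ψ∘T : ∀ ψ → Σ𝔽 (ext ψ) ≡ 0ℤ → ψ 0ₛ ≡ 1ℤ → Σ𝔽 (λ x → ψ (T u x)) ≡ + Q
      Σ-ψ∘T ψ Σψ ψ0 = begin
        -- The `H`-th power inverts the substitution: squaring followed by it is `conj`, and two
        -- conjugations cancel.
        Σ𝔽 F                              ≡⟨ Σ-reindex (λ X → conj X ^ 2) (_^ H) left right F ⟩
        Σ𝔽 F′                             ≡⟨ Σ-cong split ⟩
        Σ𝔽 (λ X → ι X ℤ.+ R X)            ≡⟨ Σ-+ ι R ⟩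
        Σ𝔽 ι ℤ.+ Σ𝔽 R                     ≡⟨ cong₂ ℤ._+_ Σι ΣR ⟩
        + Q ℤ.+ 0ℤ                        ≡⟨ ℤ.+-identityʳ _ ⟩
        + Q                               ∎
        where
        F F′ R : Carrier → ℤ
        F x  = ψ (T u x)
        F′ X = F (conj X ^ 2)
        R X  = (1ℤ ℤ.- ι X) ℤ.* F′ X
        t : Carrier → Carrier
        t X = proj₁ (T u (conj X ^ 2))
        ^2^H : ∀ x → (x ^ 2) ^ H ≡ conj x
        ^2^H x = trans (^-assocʳ x 2 H) (cong (x ^_) 2*H≡Q)
        left : ∀ x → conj (x ^ H) ^ 2 ≡ x
        left x = begin
          conj (x ^ H) ^ 2     ≡⟨ ^-comm (x ^ H) Q 2 ⟩
          conj ((x ^ H) ^ 2)   ≡⟨ cong conj (^-comm x H 2) ⟩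
          conj ((x ^ 2) ^ H)   ≡⟨ cong conj (^2^H x) ⟩
          conj (conj x)        ≡⟨ conj-conj x ⟩
          x                    ∎
        right : ∀ x → (conj x ^ 2) ^ H ≡ x
        right x = trans (^2^H (conj x)) (conj-conj x)
        F≡ext : ∀ x → F x ≡ ext ψ (proj₁ (T u x))
        F≡ext x = sym (ext-yes ψ (proj₂ (T u x)))
        F-fixed : ∀ {x} → Fixed x → F x ≡ 1ℤ
        F-fixed {x} p = begin
          F x                       ≡⟨ F≡ext x ⟩
          ext ψ (proj₁ (T u x))     ≡⟨ cong (ext ψ) (T-fixed u p) ⟩
          ext ψ 0#                  ≡⟨ ext-yes ψ (0^2^ m) ⟩
          ψ 0ₛ                      ≡⟨ ψ0 ⟩
          1ℤ                        ∎
        split : ∀ X → F′ X ≡ ι X ℤ.+ R X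
        split X = case (conj X ≟ X)
          where
          at-0 : ∀ f → f ≡ 0ℤ ℤ.+ (1ℤ ℤ.- 0ℤ) ℤ.* f
          at-0 = ℤ-solve-∀
          case : Dec (Fixed X) → F′ X ≡ ι X ℤ.+ (1ℤ ℤ.- ι X) ℤ.* F′ X
          case (yes p) = trans F′≡1 (sym (cong₂ (λ i f → i ℤ.+ (1ℤ ℤ.- i) ℤ.* f) (ι-yes p) F′≡1))
            where F′≡1 = F-fixed (fixed-^ 2 (fixed-^ Q p))
          case (no ¬p) = trans (at-0 (F′ X)) (sym (cong (λ i → i ℤ.+ (1ℤ ℤ.- i) ℤ.* F′ X) (ι-no ¬p)))
        -- The right side needs no weight `ι e`: since `t X` lies in the subfield, `ext ψ (t X + e)`
        -- is 0 unless `e` does too. The sum over `e` can then be translated by `t X` in the whole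
        -- field.
        R-shift : ∀ X e → ι e ℤ.* R (shift e X) ≡ (1ℤ ℤ.- ι X) ℤ.* ext ψ (t X + e)
        R-shift X e = case (conj e ≟ e) (conj X ≟ X)
          where
          cancel : t X + e + t X ≡ e
          cancel = trans (cong (_+ t X) (+-comm (t X) e)) (x+y+y≡x e (t X))
          case : Dec (Fixed e) → Dec (Fixed X) → ι e ℤ.* R (shift e X) ≡ (1ℤ ℤ.- ι X) ℤ.* ext ψ (t X + e)
          case (no ¬p) _ = trans (cong (ℤ._* R (shift e X)) (ι-no ¬p)) (sym (trans
            (cong ((1ℤ ℤ.- ι X) ℤ.*_) (ext-no ψ (λ q → ¬p (subst Fixed cancel (fixed-+ q (proj₂ (T u (conj X ^ 2))))))))
            (ℤ.*-zeroʳ (1ℤ ℤ.- ι X))))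
          case (yes p) (yes q) = trans
            (cong (λ i → ι e ℤ.* ((1ℤ ℤ.- i) ℤ.* F′ (shift e X))) (trans (ι-shift p X) (ι-yes q)))
            (trans (ℤ.*-zeroʳ (ι e)) (sym (cong (λ i → (1ℤ ℤ.- i) ℤ.* ext ψ (t X + e)) (ι-yes q))))
          case (yes p) (no X∉) = begin
            ι e ℤ.* R (shift e X)                             ≡⟨ cong (ℤ._* R (shift e X)) (ι-yes p) ⟩
            1ℤ ℤ.* R (shift e X)                              ≡⟨ ℤ.*-identityˡ (R (shift e X)) ⟩
            (1ℤ ℤ.- ι (shift e X)) ℤ.* F′ (shift e X)         ≡⟨ cong₂ (λ i f → (1ℤ ℤ.- i) ℤ.* f) (ι-shift p X) (F≡ext (conj (shift e X) ^ 2)) ⟩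
            (1ℤ ℤ.- ι X) ℤ.* ext ψ (t (shift e X))            ≡⟨ cong (λ s → (1ℤ ℤ.- ι X) ℤ.* ext ψ s) (T-shift p X X∉) ⟩
            (1ℤ ℤ.- ι X) ℤ.* ext ψ (t X + e)                  ∎
        -- Averaging over the shifts turns each value of R into a multiple of Σψ.
        ΣR : Σ𝔽 R ≡ 0ℤ
        ΣR = ℤ.*-cancelˡ-≡ (+ Q) (Σ𝔽 R) 0ℤ {{Q-nonZero}} (begin
          + Q ℤ.* Σ𝔽 R                                              ≡⟨ Σι* (Σ𝔽 R) ⟨
          Σ𝔽 (λ e → ι e ℤ.* Σ𝔽 R)                                   ≡⟨ Σ-cong reindex ⟩
          Σ𝔽 (λ e → Σ𝔽 (λ X → ι e ℤ.* R (shift e X)))               ≡⟨ Σ-swap (λ e X → ι e ℤ.* R (shift e X)) ⟩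
          Σ𝔽 (λ X → Σ𝔽 (λ e → ι e ℤ.* R (shift e X)))               ≡⟨ Σ-cong inner ⟩
          Σ𝔽 (λ _ → 0ℤ)                                             ≡⟨ Σ-0 ⟩
          0ℤ                                                        ≡⟨ ℤ.*-zeroʳ (+ Q) ⟨
          + Q ℤ.* 0ℤ                                                ∎)
          where
          reindex : ∀ e → ι e ℤ.* Σ𝔽 R ≡ Σ𝔽 (λ X → ι e ℤ.* R (shift e X))
          reindex e = case (conj e ≟ e)
            where
            case : Dec (Fixed e) → ι e ℤ.* Σ𝔽 R ≡ Σ𝔽 (λ X → ι e ℤ.* R (shift e X))
            case (no ¬p) = trans (cong (ℤ._* Σ𝔽 R) (ι-no ¬p))
              (sym (trans (Σ-cong (λ X → cong (ℤ._* R (shift e X)) (ι-no ¬p))) Σ-0))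
            case (yes p) = trans
              (cong (ι e ℤ.*_) (Σ-reindex (shift e) (shift e) (shift-involutive p) (shift-involutive p) R))
              (Σ-*ˡ (ι e) (λ X → R (shift e X)))
          inner : ∀ X → Σ𝔽 (λ e → ι e ℤ.* R (shift e X)) ≡ 0ℤ
          inner X = begin
            Σ𝔽 (λ e → ι e ℤ.* R (shift e X))                     ≡⟨ Σ-cong (R-shift X) ⟩
            Σ𝔽 (λ e → (1ℤ ℤ.- ι X) ℤ.* ext ψ (t X + e))          ≡⟨ Σ-*ˡ (1ℤ ℤ.- ι X) (λ e → ext ψ (t X + e)) ⟨
            (1ℤ ℤ.- ι X) ℤ.* Σ𝔽 (λ e → ext ψ (t X + e))          ≡⟨ cong ((1ℤ ℤ.- ι X) ℤ.*_) (Σ-reindex (λ e → t X + e) (λ e → t X + e) cancel cancel (ext ψ)) ⟨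
            (1ℤ ℤ.- ι X) ℤ.* Σ𝔽 (ext ψ)                          ≡⟨ cong ((1ℤ ℤ.- ι X) ℤ.*_) Σψ ⟩
            (1ℤ ℤ.- ι X) ℤ.* 0ℤ                                  ≡⟨ ℤ.*-zeroʳ (1ℤ ℤ.- ι X) ⟩
            0ℤ                                                   ∎
            where
            cancel : ∀ e → t X + (t X + e) ≡ e
            cancel e = trans (+-comm _ _) (trans (cong (_+ t X) (+-comm (t X) e)) (x+y+y≡x e (t X)))

      -- Orthogonality over the subfield and sums of invariant functions against χ

      module _ (z : Carrier) (Tr₁z : Tr₁ z ≡ true) where

        -- The subfield is its own annihilator under the pairing `Tr₁ (x * y)`. For `x` outside it,
        -- some `y₀` in the subfield has `χ (x * y₀) = -1`, and translating by `y₀` negates the sum.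
        Σ-χ-subfield : ∀ x → Σ𝔽 (λ y → ι y ℤ.* χ (x * y)) ≡ + Q ℤ.* ι x
        Σ-χ-subfield x with conj x ≟ x
        ... | yes p = trans (Σ-cong trivial) (Σι* 1ℤ)
          where
          trivial : ∀ y → ι y ℤ.* χ (x * y) ≡ ι y ℤ.* 1ℤ
          trivial y with conj y ≟ y
          ... | no _   = refl
          ... | yes p′ = cong (1ℤ ℤ.*_) (χ-fixed (fixed-* p p′))
        ... | no x∉ = trans (i≡-i⇒i≡0 S S≡-S) (sym (ℤ.*-zeroʳ (+ Q)))
          where
          d≢0 : tr x ≢ 0#
          d≢0 e = x∉ (tr≡0⇒fixed e)
          -- Chosen so that `x * y₀` and `z` have the same relative trace. They then differ by a
          -- subfield element, on which χ is 1, so `χ (x * y₀)` equals `χ z`.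
          y₀ : Carrier
          y₀ = tr z * tr x ⁻¹
          y₀-fixed : Fixed y₀
          y₀-fixed = fixed-* (tr-fixed z) (fixed-⁻¹ (tr-fixed x))
          xy₀+z-fixed : Fixed (y₀ * x + z)
          xy₀+z-fixed = tr≡0⇒fixed (begin
            tr (y₀ * x + z)        ≡⟨ tr-+ (y₀ * x) z ⟩
            tr (y₀ * x) + tr z     ≡⟨ cong (_+ tr z) (tr-*ˡ y₀-fixed x) ⟩
            y₀ * tr x + tr z       ≡⟨ cong (_+ tr z) (*-⁻¹-cancel d≢0 (tr z)) ⟩
            tr z + tr z            ≡⟨ x+x≡0 (tr z) ⟩
            0#                     ∎)
          χxy₀ : χ (x * y₀) ≡ -1ℤ
          χxy₀ = begin
            χ (x * y₀)                ≡⟨ cong χ (*-comm x y₀) ⟩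
            χ (y₀ * x)                ≡⟨ cong χ (x+y+y≡x (y₀ * x) z) ⟨
            χ (y₀ * x + z + z)        ≡⟨ χ-+ (y₀ * x + z) z ⟩
            χ (y₀ * x + z) ℤ.* χ z    ≡⟨ cong₂ ℤ._*_ (χ-fixed xy₀+z-fixed) (cong -1^ Tr₁z) ⟩
            -1ℤ                       ∎
          S : ℤ
          S = Σ𝔽 (λ y → ι y ℤ.* χ (x * y))
          ι-translate : ∀ y → ι (y + y₀) ≡ ι y
          ι-translate y = []-cong (λ q → subst Fixed (x+y+y≡x y y₀) (fixed-+ q y₀-fixed)) (λ q → fixed-+ q y₀-fixed) _ _
          negate : ∀ y → ι (y + y₀) ℤ.* χ (x * (y + y₀)) ≡ -1ℤ ℤ.* (ι y ℤ.* χ (x * y))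
          negate y = begin
            ι (y + y₀) ℤ.* χ (x * (y + y₀))           ≡⟨ cong₂ (λ i w → i ℤ.* χ w) (ι-translate y) (distribˡ x y y₀) ⟩
            ι y ℤ.* χ (x * y + x * y₀)                ≡⟨ cong (ι y ℤ.*_) (χ-+ (x * y) (x * y₀)) ⟩
            ι y ℤ.* (χ (x * y) ℤ.* χ (x * y₀))        ≡⟨ cong (λ c → ι y ℤ.* (χ (x * y) ℤ.* c)) χxy₀ ⟩
            ι y ℤ.* (χ (x * y) ℤ.* -1ℤ)               ≡⟨ ℤ.*-assoc (ι y) (χ (x * y)) -1ℤ ⟨
            ι y ℤ.* χ (x * y) ℤ.* -1ℤ                 ≡⟨ ℤ.*-comm _ -1ℤ ⟩
            -1ℤ ℤ.* (ι y ℤ.* χ (x * y))               ∎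
          S≡-S : S ≡ ℤ.- S
          S≡-S = begin
            S                                                 ≡⟨ Σ-reindex (_+ y₀) (_+ y₀) (λ y → x+y+y≡x y y₀) (λ y → x+y+y≡x y y₀) (λ y → ι y ℤ.* χ (x * y)) ⟩
            Σ𝔽 (λ y → ι (y + y₀) ℤ.* χ (x * (y + y₀)))        ≡⟨ Σ-cong negate ⟩
            Σ𝔽 (λ y → -1ℤ ℤ.* (ι y ℤ.* χ (x * y)))            ≡⟨ Σ-*ˡ -1ℤ (λ y → ι y ℤ.* χ (x * y)) ⟨
            -1ℤ ℤ.* S                                         ≡⟨ ℤ.-1*i≡-i S ⟩
            ℤ.- S                                             ∎

        -- Evaluate Σ_y Σ_x G(x) χ(xy), with y in the subfield, in both orders.
        Σ-invariant-χ : ∀ G → (∀ {y} → Fixed y → y ≢ 0# → ∀ x → G (y * x) ≡ G x) →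
                        Σ𝔽 G ≡ + Q ℤ.* G 0# → Σ𝔽 (λ x → G x ℤ.* χ x) ≡ + Q ℤ.* G 1#
        Σ-invariant-χ G invariant ΣG = ℤ.*-cancelˡ-≡ (+ Q ℤ.- 1ℤ) W (+ Q ℤ.* G 1#) {{Q-1-nonZero}}
            (compare (+ Q) W (G 0#) (G 1#) (begin
          + Q ℤ.* W ℤ.+ (+ Q ℤ.* G 0# ℤ.- W)       ≡⟨ cong (λ s → + Q ℤ.* W ℤ.+ (s ℤ.- W)) ΣG ⟨
          + Q ℤ.* W ℤ.+ (Σ𝔽 G ℤ.- W)               ≡⟨ by-y ⟨
          D                                        ≡⟨ by-x ⟩
          + Q ℤ.* (+ Q ℤ.* G 1# ℤ.+ (G 0# ℤ.- G 1#)) ∎))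
          where
          W D : ℤ
          W = Σ𝔽 (λ x → G x ℤ.* χ x)
          D = Σ𝔽 (λ y → ι y ℤ.* Σ𝔽 (λ x → G x ℤ.* χ (x * y)))
          -- The contribution `Q * a` of y = 0, which is Σ G, cancels against that of x = 0; what
          -- remains is a multiple of `Q - 1` on both sides.
          compare : ∀ Q W a b → Q ℤ.* W ℤ.+ (Q ℤ.* a ℤ.- W) ≡ Q ℤ.* (Q ℤ.* b ℤ.+ (a ℤ.- b)) →
                    (Q ℤ.- 1ℤ) ℤ.* W ≡ (Q ℤ.- 1ℤ) ℤ.* (Q ℤ.* b)
          compare Q W a b e = begin
            (Q ℤ.- 1ℤ) ℤ.* W                                    ≡⟨ lhs Q W a ⟩
            Q ℤ.* W ℤ.+ (Q ℤ.* a ℤ.- W) ℤ.- Q ℤ.* a             ≡⟨ cong (ℤ._- Q ℤ.* a) e ⟩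
            Q ℤ.* (Q ℤ.* b ℤ.+ (a ℤ.- b)) ℤ.- Q ℤ.* a           ≡⟨ rhs Q a b ⟩
            (Q ℤ.- 1ℤ) ℤ.* (Q ℤ.* b)                            ∎
            where
            lhs : ∀ Q W a → (Q ℤ.- 1ℤ) ℤ.* W ≡ Q ℤ.* W ℤ.+ (Q ℤ.* a ℤ.- W) ℤ.- Q ℤ.* a
            lhs = ℤ-solve-∀
            rhs : ∀ Q a b → Q ℤ.* (Q ℤ.* b ℤ.+ (a ℤ.- b)) ℤ.- Q ℤ.* a ≡ (Q ℤ.- 1ℤ) ℤ.* (Q ℤ.* b)
            rhs = ℤ-solve-∀
          -- The value `b` is summed over the entire subfield and then corrected by `a - b` at 0;
          -- both orders of summation end in such a sum.
          Σι-two-valued : ∀ a b (f : Carrier → ℤ) → f 0# ≡ a → (∀ {x} → Fixed x → x ≢ 0# → f x ≡ b) →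
                          Σ𝔽 (λ x → ι x ℤ.* f x) ≡ + Q ℤ.* b ℤ.+ (a ℤ.- b)
          Σι-two-valued a b f f0 f≢0 = begin
            Σ𝔽 (λ x → ι x ℤ.* f x)                                        ≡⟨ Σ-cong pointwise ⟩
            Σ𝔽 (λ x → ι x ℤ.* b ℤ.+ [ x ≟ 0# ] ℤ.* (a ℤ.- b))             ≡⟨ Σ-+ (λ x → ι x ℤ.* b) (λ x → [ x ≟ 0# ] ℤ.* (a ℤ.- b)) ⟩
            Σ𝔽 (λ x → ι x ℤ.* b) ℤ.+ Σ𝔽 (λ x → [ x ≟ 0# ] ℤ.* (a ℤ.- b))  ≡⟨ cong₂ ℤ._+_ (Σι* b) (Σ-δ 0# (a ℤ.- b)) ⟩
            + Q ℤ.* b ℤ.+ (a ℤ.- b)                                       ∎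
            where
            at-0 : ∀ a b → 1ℤ ℤ.* a ≡ 1ℤ ℤ.* b ℤ.+ 1ℤ ℤ.* (a ℤ.- b)
            at-0 = ℤ-solve-∀
            pointwise : ∀ x → ι x ℤ.* f x ≡ ι x ℤ.* b ℤ.+ [ x ≟ 0# ] ℤ.* (a ℤ.- b)
            pointwise x with x ≟ 0#
            ... | yes refl = begin
              ι 0# ℤ.* f 0#                         ≡⟨ cong₂ ℤ._*_ (ι-yes (0^2^ m)) f0 ⟩
              1ℤ ℤ.* a                              ≡⟨ at-0 a b ⟩
              1ℤ ℤ.* b ℤ.+ 1ℤ ℤ.* (a ℤ.- b)         ≡⟨ cong (λ i → i ℤ.* b ℤ.+ 1ℤ ℤ.* (a ℤ.- b)) (ι-yes (0^2^ m)) ⟨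
              ι 0# ℤ.* b ℤ.+ 1ℤ ℤ.* (a ℤ.- b)       ∎
            ... | no x≢0 with conj x ≟ x
            ...   | yes p = trans (cong (1ℤ ℤ.*_) (f≢0 p x≢0)) (sym (ℤ.+-identityʳ _))
            ...   | no _  = refl
          -- For nonzero `y` in the subfield, invariance of `G` lets the substitution of `y * x` for
          -- `x` absorb `y`, so the inner sum is `W`. At y = 0 the character is 1 and the inner sum
          -- is Σ G.
          by-y : D ≡ + Q ℤ.* W ℤ.+ (Σ𝔽 G ℤ.- W)
          by-y = Σι-two-valued (Σ𝔽 G) W (λ y → Σ𝔽 (λ x → G x ℤ.* χ (x * y)))
            (Σ-cong (λ x → trans (cong (G x ℤ.*_) (χ-fixed (subst Fixed (sym (zeroʳ x)) (0^2^ m)))) (ℤ.*-identityʳ (G x))))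
            (λ {y} p y≢0 → begin
              Σ𝔽 (λ x → G x ℤ.* χ (x * y))        ≡⟨ Σ-cong (λ x → cong₂ (λ g w → g ℤ.* χ w) (sym (invariant p y≢0 x)) (*-comm x y)) ⟩
              Σ𝔽 (λ x → G (y * x) ℤ.* χ (y * x))  ≡⟨ Σ-reindex (y *_) (y ⁻¹ *_) (scale (⁻¹-inverseʳ y≢0)) (scale (trans (*-comm _ y) (⁻¹-inverseʳ y≢0))) (λ x → G x ℤ.* χ x) ⟨
              W                                   ∎)
          by-x : D ≡ + Q ℤ.* (+ Q ℤ.* G 1# ℤ.+ (G 0# ℤ.- G 1#))
          by-x = begin
            D                                                            ≡⟨ Σ-cong (λ y → Σ-*ˡ (ι y) (λ x → G x ℤ.* χ (x * y))) ⟩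
            Σ𝔽 (λ y → Σ𝔽 (λ x → ι y ℤ.* (G x ℤ.* χ (x * y))))            ≡⟨ Σ-swap (λ y x → ι y ℤ.* (G x ℤ.* χ (x * y))) ⟩
            Σ𝔽 (λ x → Σ𝔽 (λ y → ι y ℤ.* (G x ℤ.* χ (x * y))))            ≡⟨ Σ-cong row ⟩
            Σ𝔽 (λ x → + Q ℤ.* (ι x ℤ.* G x))                             ≡⟨ Σ-*ˡ (+ Q) (λ x → ι x ℤ.* G x) ⟨
            + Q ℤ.* Σ𝔽 (λ x → ι x ℤ.* G x)                               ≡⟨ cong (+ Q ℤ.*_) (Σι-two-valued (G 0#) (G 1#) G refl
                                                                             (λ {x} p x≢0 → trans (cong G (sym (*-identityʳ x))) (invariant p x≢0 1#))) ⟩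
            + Q ℤ.* (+ Q ℤ.* G 1# ℤ.+ (G 0# ℤ.- G 1#))                   ∎
            where
            pull : ∀ a b c → a ℤ.* (b ℤ.* c) ≡ b ℤ.* (a ℤ.* c)
            pull = ℤ-solve-∀
            push : ∀ g Q i → g ℤ.* (Q ℤ.* i) ≡ Q ℤ.* (i ℤ.* g)
            push = ℤ-solve-∀
            row : ∀ x → Σ𝔽 (λ y → ι y ℤ.* (G x ℤ.* χ (x * y))) ≡ + Q ℤ.* (ι x ℤ.* G x)
            row x = begin
              Σ𝔽 (λ y → ι y ℤ.* (G x ℤ.* χ (x * y)))    ≡⟨ Σ-cong (λ y → pull (ι y) (G x) (χ (x * y))) ⟩
              Σ𝔽 (λ y → G x ℤ.* (ι y ℤ.* χ (x * y)))    ≡⟨ Σ-*ˡ (G x) (λ y → ι y ℤ.* χ (x * y)) ⟨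
              G x ℤ.* Σ𝔽 (λ y → ι y ℤ.* χ (x * y))      ≡⟨ cong (G x ℤ.*_) (Σ-χ-subfield x) ⟩
              G x ℤ.* (+ Q ℤ.* ι x)                     ≡⟨ push (G x) (+ Q) (ι x) ⟩
              + Q ℤ.* (ι x ℤ.* G x)                     ∎

  -- Walsh sums with an arbitrary invertible exponent

  hyperBent : ∀ {u} → ¬ Fixed u → Σ𝔽 ι ≡ + Q → (g : Subfield → Bool) →
              Σ𝔽 (ext (λ y → -1^ (g y))) ≡ 0ℤ → g 0ₛ ≡ false → HyperBent (λ x → g (T u x))
  hyperBent {u} u∉ Σι g Σg g0 c t coprime = walsh (c ≟ 0#) (Fin.any? (λ i → Tr₁ (elem i) Bool.≟ true))
    where
    F : Carrier → ℤ
    F x = -1^ (g (T u x))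
    W : ℤ
    W = Σ𝔽 (λ x → -1^ (g (T u x) xor Tr₁ (c * x ^ᶻ t)))
    ΣF : Σ𝔽 F ≡ + Q
    ΣF = Σ-ψ∘T u u∉ Σι (λ y → -1^ (g y)) Σg (cong -1^ g0)
    W≡ : W ≡ Σ𝔽 (λ x → F x ℤ.* χ (c * x ^ᶻ t))
    W≡ = Σ-cong (λ x → -1^-xor (g (T u x)) (Tr₁ (c * x ^ᶻ t)))
    F-cong : ∀ {x y} → proj₁ (T u x) ≡ proj₁ (T u y) → F x ≡ F y
    F-cong {x} {y} e = begin
      F x                                       ≡⟨ ext-yes (λ s → -1^ (g s)) (proj₂ (T u x)) ⟨
      ext (λ s → -1^ (g s)) (proj₁ (T u x))     ≡⟨ cong (ext (λ s → -1^ (g s))) e ⟩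
      ext (λ s → -1^ (g s)) (proj₁ (T u y))     ≡⟨ ext-yes (λ s → -1^ (g s)) (proj₂ (T u y)) ⟩
      F y                                       ∎
    F0 : F 0# ≡ 1ℤ
    F0 = begin
      F 0#                                      ≡⟨ ext-yes (λ s → -1^ (g s)) (proj₂ (T u 0#)) ⟨
      ext (λ s → -1^ (g s)) (proj₁ (T u 0#))    ≡⟨ cong (ext (λ s → -1^ (g s))) (T-fixed u (0^2^ m)) ⟩
      ext (λ s → -1^ (g s)) 0#                  ≡⟨ ext-yes (λ s → -1^ (g s)) (0^2^ m) ⟩
      -1^ (g 0ₛ)                                ≡⟨ cong -1^ g0 ⟩
      1ℤ                                        ∎
    trivial : (∀ x → χ (c * x ^ᶻ t) ≡ 1ℤ) → W ≡ + Q
    trivial e = begin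
      W                                    ≡⟨ W≡ ⟩
      Σ𝔽 (λ x → F x ℤ.* χ (c * x ^ᶻ t))    ≡⟨ Σ-cong (λ x → trans (cong (F x ℤ.*_) (e x)) (ℤ.*-identityʳ (F x))) ⟩
      Σ𝔽 F                                 ≡⟨ ΣF ⟩
      + Q                                  ∎
    sign : ∀ b → + Q ℤ.* -1^ b ≡ + Q ⊎ + Q ℤ.* -1^ b ≡ ℤ.- (+ Q)
    sign false = inj₁ (ℤ.*-identityʳ (+ Q))
    sign true  = inj₂ (trans (ℤ.*-comm (+ Q) -1ℤ) (ℤ.-1*i≡-i (+ Q)))
    nontrivial : ∀ z → Tr₁ z ≡ true → c ≢ 0# →
                 (∃[ s ] (∀ x → (x ^ s) ^ᶻ t ≡ x) × (∀ x → (x ^ᶻ t) ^ s ≡ x)) → ∃[ b ] W ≡ + Q ℤ.* -1^ b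
    -- The sign comes out explicitly as the value of the function at `θ 1`, the s-th power of the
    -- inverse of `c`; this describes the dual function.
    nontrivial z Tr₁z c≢0 (s , root , power) = g (T u (θ 1#)) , (begin
      W                                              ≡⟨ W≡ ⟩
      Σ𝔽 (λ x → F x ℤ.* χ (c * x ^ᶻ t))              ≡⟨ reindex (λ x → F x ℤ.* χ (c * x ^ᶻ t)) ⟩
      Σ𝔽 (λ x → F (θ x) ℤ.* χ (c * θ x ^ᶻ t))        ≡⟨ Σ-cong (λ x → cong (λ w → F (θ x) ℤ.* χ w) (cθ x)) ⟩
      Σ𝔽 (λ x → F (θ x) ℤ.* χ x)                     ≡⟨ Σ-invariant-χ u u∉ Σι z Tr₁z (λ x → F (θ x)) invariant ΣFθ ⟩
      + Q ℤ.* F (θ 1#)                               ∎)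
      where
      θ : Carrier → Carrier
      θ x = (c ⁻¹ * x) ^ s
      cθ : ∀ x → c * θ x ^ᶻ t ≡ x
      cθ x = trans (cong (c *_) (root (c ⁻¹ * x))) (scale (⁻¹-inverseʳ c≢0) x)
      θc : ∀ x → θ (c * x ^ᶻ t) ≡ x
      θc x = trans (cong (_^ s) (scale (trans (*-comm _ c) (⁻¹-inverseʳ c≢0)) (x ^ᶻ t))) (power x)
      reindex : ∀ f → Σ𝔽 f ≡ Σ𝔽 (λ x → f (θ x))
      reindex = Σ-reindex θ (λ x → c * x ^ᶻ t) θc cθ
      invariant : ∀ {y} → Fixed y → y ≢ 0# → ∀ x → F (θ (y * x)) ≡ F (θ x)
      invariant {y} p y≢0 x = begin
        F (θ (y * x))      ≡⟨ cong F (begin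
          (c ⁻¹ * (y * x)) ^ s       ≡⟨ cong (_^ s) (solve 3 (λ a b c → a :* (b :* c) := b :* (a :* c)) refl (c ⁻¹) y x) ⟩
          (y * (c ⁻¹ * x)) ^ s       ≡⟨ ^-distrib-* y (c ⁻¹ * x) s ⟩
          y ^ s * θ x                ∎) ⟩
        F (y ^ s * θ x)    ≡⟨ F-cong (T-homogeneous u (fixed-^ s p) (^≢0 y≢0 s) (θ x)) ⟩
        F (θ x)            ∎
      -- Whatever `0 ^ s` is, it lies in the subfield, where `T` vanishes, so `F (θ 0)` agrees with
      -- `F 0`.
      θ0-fixed : Fixed (θ 0#)
      θ0-fixed = fixed-^ s (subst Fixed (sym (zeroʳ (c ⁻¹))) (0^2^ m))
      ΣFθ : Σ𝔽 (λ x → F (θ x)) ≡ + Q ℤ.* F (θ 0#)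
      ΣFθ = begin
        Σ𝔽 (λ x → F (θ x))     ≡⟨ reindex F ⟨
        Σ𝔽 F                   ≡⟨ ΣF ⟩
        + Q                    ≡⟨ ℤ.*-identityʳ (+ Q) ⟨
        + Q ℤ.* 1ℤ             ≡⟨ cong (+ Q ℤ.*_) F0 ⟨
        + Q ℤ.* F 0#           ≡⟨ cong (+ Q ℤ.*_) (F-cong (trans (T-fixed u θ0-fixed) (sym (T-fixed u (0^2^ m))))) ⟨
        + Q ℤ.* F (θ 0#)       ∎
    -- If Tr₁ vanished identically, W would be Σ F = Q; so the nontriviality
    -- of the trace does not have to be established.
    walsh : Dec (c ≡ 0#) → Dec (∃[ i ] Tr₁ (elem i) ≡ true) → W ≡ + Q ⊎ W ≡ ℤ.- (+ Q)
    walsh (yes c≡0) _ = inj₁ (trivial (λ x → χ-fixed u u∉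
      (subst Fixed (sym (trans (cong (_* x ^ᶻ t) c≡0) (zeroˡ (x ^ᶻ t)))) (0^2^ m))))
    walsh (no _) (no none) = inj₁ (trivial (λ x → cong -1^ (Bool.¬-not (λ e →
      none (index (c * x ^ᶻ t) , trans (cong Tr₁ (elem-index (c * x ^ᶻ t))) e)))))
    walsh (no c≢0) (yes (i , e)) = conclude (nontrivial (elem i) e c≢0 (^ᶻ-root t coprime))
      where
      conclude : (∃[ b ] W ≡ + Q ℤ.* -1^ b) → W ≡ + Q ⊎ W ≡ ℤ.- (+ Q)
      conclude (b , W≡±) = Sum.map (trans W≡±) (trans W≡±) (sign b)

theorem4 : (m k : ℕ) → 2 ≤ m → 1 ≤ k →
    (K : FiniteField (2 ℕ.^ (2 ℕ.* m))) →
    let open QuadraticExtension m K in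
    (U : Carrier → Set) → IsCyclicSubgroupOfOrder (2 ℕ.^ m ℕ.+ 1) U →
    (u₀ : Carrier) → U u₀ → u₀ ≢ 1# →
    (h : Subfield → 𝔽₂^ k) → Balanced h → h 0ₛ ≡ 𝟎 →
    VectorialHyperBent (λ x → h (T u₀ x))
theorem4 m k 2≤m _ K U cyclic u₀ Uu₀ u₀≢1 h balanced h0 v v≢𝟎 =
  hyperBent (norm1⇒¬fixed (lagrange cyclic u₀ Uu₀) u₀≢1) (Σι≡Q h balanced)
    (λ y → ⟨ v , h y ⟩) (Σ-component≡0 h balanced v v≢𝟎) (trans (cong ⟨ v ,_⟩ h0) (⟨-,𝟎⟩ v))
  where
  open Quadratic m 2≤m K
  open Powers K (3≤q m 2≤m)
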